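{- Let $H(u,1,z,t)=\sum_{w}u^{\mathrm{asc}(w)}z^{\mathrm{zeros}(w)}t^{\mathrm{length}(w)}$, the sum over all nonempty ascent sequences $w$. Then, as formal power series in $u$, $$H(u,1,z,t)=\sum_{s=0}^{\infty}\frac{zt(1-u)u^s(1-t)^s}{\delta_s\prod_{i=1}^{s+1}\gamma_i}.$$
   Context: A sequence $(x_1,\dots,x_n)$ of nonnegative integers, $n\ge1$, is an ascent sequence if $x_1=0$ and $x_i\in\{0,1,\dots,1+\mathrm{asc}(x_1,\dots,x_{i-1})\}$ for all $2\le i\le n$, where $\mathrm{asc}(y_1,\dots,y_k)=|\{1\le j<k: y_j<y_{j+1}\}|$. For $w=(x_1,\dots,x_n)$: $\mathrm{length}(w)=n$, $\mathrm{asc}(w)$ the number of ascents, $\mathrm{zeros}(w)$ the number of entries equal to $0$. For $k\ge1$, $\delta_k=u-(1-t)^k(u-1)$ and $\gamma_k=u-(1-zt)(1-t)^{k-1}(u-1)$; $\delta_0=\gamma_0=1$. -}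

module Defs where

open import Data.Nat as ℕ using (ℕ; zero; suc; _∸_; _≤_; _<_; _≤?_; _<ᵇ_)
import Data.Nat.Properties as ℕP
open import Data.Integer as ℤ using (ℤ; +_; _+_; _-_; _*_)
open import Data.List using (List; []; _∷_; length; filter; take; upTo; applyUpTo; concatMap; map)
open import Data.List.Relation.Unary.All using (All; all?)
open import Data.Product using (_×_)
open import Data.Bool using (if_then_else_)
open import Relation.Binary.PropositionalEquality using (_≡_)
open import Relation.Nullary using (Dec)
open import Relation.Nullary.Decidable using (_×-dec_)

asc : List ℕ → ℕ
asc []           = 0
asc (x ∷ [])     = 0
asc (x ∷ y ∷ r)  = (if x <ᵇ y then 1 else 0) ℕ.+ asc (y ∷ r)

zeros : List ℕ → ℕ
zeros w = length (filter (ℕ._≟ 0) w)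

-- 0-based access (default 0 out of range; only used in range)
nth : List ℕ → ℕ → ℕ
nth []      _       = 0
nth (x ∷ _) zero    = x
nth (_ ∷ w) (suc i) = nth w i

-- w = (x_1,…,x_n) is an ascent sequence: n ≥ 1, x_1 = 0, and for the
-- 0-based positions i = 1,…,n-1 (i.e. x_{i+1}, i+1 = 2..n):
--   x_{i+1} ≤ 1 + asc(x_1,…,x_i)
IsAscent : List ℕ → Set
IsAscent w = (1 ≤ length w) × (nth w 0 ≡ 0)
           × All (λ i → nth w i ≤ suc (asc (take i w))) (applyUpTo suc (length w ∸ 1))

isAscent? : (w : List ℕ) → Dec (IsAscent w)
isAscent? w = (1 ≤? length w) ×-dec (nth w 0 ℕ.≟ 0)
            ×-dec all? (λ i → nth w i ≤? suc (asc (take i w))) (applyUpTo suc (length w ∸ 1))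

cands : ℕ → ℕ → List (List ℕ)
cands zero    m = [] ∷ []
cands (suc k) m = concatMap (λ x → map (x ∷_) (cands k m)) (upTo m)

-- number of ascent sequences w with length n, asc w = a, zeros w = b.
-- (Every ascent sequence of length n has entries ≤ n-1 < n, so it
-- occurs exactly once in cands n n.)
ascCount : ℕ → ℕ → ℕ → ℕ
ascCount a b n = length (filter (λ w → isAscent? w ×-dec (asc w ℕ.≟ a) ×-dec (zeros w ℕ.≟ b)) (cands n n))

-- Formal power series in u, z, t over ℤ, as coefficient functions:
-- f a b c = coefficient of u^a z^b t^c.

Series : Set
Series = ℕ → ℕ → ℕ → ℤ

sumTo : ℕ → (ℕ → ℤ) → ℤ
sumTo zero    f = + 0
sumTo (suc n) f = sumTo n f + f n

cst : ℤ → Series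
cst c zero zero zero = c
cst c _    _    _    = + 0

one : Series
one = cst (+ 1)

U Z T : Series
U (suc zero) zero zero = + 1
U _ _ _ = + 0
Z zero (suc zero) zero = + 1
Z _ _ _ = + 0
T zero zero (suc zero) = + 1
T _ _ _ = + 0

infixl 6 _⊕_ _⊖_
infixl 7 _⊛_

_⊕_ _⊖_ _⊛_ : Series → Series → Series
(f ⊕ g) a b c = f a b c + g a b c
(f ⊖ g) a b c = f a b c - g a b c
(f ⊛ g) a b c =
  sumTo (suc a) λ i → sumTo (suc b) λ j → sumTo (suc c) λ k →
    f i j k * g (a ∸ i) (b ∸ j) (c ∸ k)

pow : Series → ℕ → Series
pow f zero    = one
pow f (suc k) = f ⊛ pow f k

-- Iteration g ↦ 1 - (f - 1) g, starting from 1.  When f has constant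
-- term 1, its fixed point is the inverse 1/f, and the m-th iterate is
-- correct in all coefficients of total degree < m.
invIter : ℕ → Series → Series
invIter zero    f = one
invIter (suc m) f = one ⊖ (f ⊖ one) ⊛ invIter m f

inv : Series → Series
inv f a b c = invIter (suc (a ℕ.+ b ℕ.+ c)) f a b c

δ : ℕ → Series
δ zero    = one
δ (suc k) = U ⊖ pow (one ⊖ T) (suc k) ⊛ (U ⊖ one)

γ : ℕ → Series
γ zero    = one
γ (suc k) = U ⊖ (one ⊖ Z ⊛ T) ⊛ pow (one ⊖ T) k ⊛ (U ⊖ one)

prodγ : ℕ → Series
prodγ zero    = one
prodγ (suc m) = prodγ m ⊛ γ (suc m)

summand : ℕ → Series
summand s = (Z ⊛ T ⊛ (one ⊖ U) ⊛ pow U s ⊛ pow (one ⊖ T) s)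
          ⊛ inv (δ s ⊛ prodγ (suc s))

{-# OPTIONS --safe #-}
module Submission where

open import Defs
open import Data.Nat using (ℕ; _<_; suc)
open import Data.Integer using (+_)
open import Data.Product using (_×_)
open import Relation.Binary.PropositionalEquality using (_≡_)

open import Algebra using (CommutativeRing; IsCommutativeRing)
import Algebra.Properties.CommutativeSemiring.Exp as Exp
open import Algebra.Properties.CommutativeSemigroup using (interchange; x∙yz≈y∙xz)
import Algebra.Properties.Ring as RingProperties
import Algebra.Properties.Semiring.Mult.TCOptimised as Mult
import Algebra.Solver.Ring as RingSolver
open import Algebra.Solver.Ring.AlmostCommutativeRing using (fromCommutativeRing; _-Raw-AlmostCommutative⟶_)
open import Data.Bool using (true; false; if_then_else_)
open import Data.Integer as ℤ using (ℤ; -[1+_])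
import Data.Integer.Properties as ℤP
open import Data.List using (List; []; _∷_; _++_; _∷ʳ_; length; filter; take; applyUpTo; concatMap; map)
open import Data.List.Properties using (length-++; filter-++; filter-≐; filter-none; filter-accept; filter-reject; ++-assoc; ++-identityʳ)
import Data.List.Relation.Unary.All as All
open import Data.List.Relation.Unary.All.Properties using (applyUpTo⁺₁; applyUpTo⁻)
open import Data.Maybe using (Maybe; just; nothing)
open import Data.Nat as ℕ using (zero; _∸_; _≤_; _<ᵇ_; z≤n; s≤s)
import Data.Nat.Properties as ℕP
open import Data.Product using (_,_; proj₁; proj₂; ∃-syntax)
open import Data.Sum using (inj₁; inj₂)
open import Function using (_∘_; id)
open import Level using (0ℓ)
open import Relation.Nullary using (¬_; Dec; yes; no; does; contradiction)
open import Relation.Nullary.Decidable using (_×-dec_)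
open import Relation.Unary using (Pred; Decidable)
import Relation.Binary.PropositionalEquality as ≡
import Relation.Binary.Reasoning.Setoid as SetoidReasoning

-- The kernel method. Appending a letter x to an ascent sequence with a ascents
-- and last letter l gives a ascents if x ≤ l and a + 1 if l < x ≤ a + 1, so with
-- v marking the last letter, H(u,v) = Σ_w u^asc v^last z^zeros t^length satisfies
--   (1 − v + tv(1 − u)) H(u,v)
--     = (1 − v)zt + t(z(1 − v) + v) H(u,1) − tuv² H(uv,1).
-- The left-hand side vanishes for v = 1/(1 + t(u − 1)) = 1/δ₁, leaving
--   γ₁ H(u,1) = zt(1 − u) + (u/δ₁) H(u/δ₁,1).
-- The k-th iterate of u ↦ u/δ₁ is u/δₖ, and iterating the equation yields the
-- series. To stay within finite sums, H is truncated at length N and the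
-- remainders, multiples of u^m and of t^(N+1), are carried along.

-- Substituting u/δₖ into H would call for composition of power series. Instead `weight`, `level`
-- and `truncated` take U and V as elements of an arbitrary commutative ring, so that substitution
-- is mere evaluation; this forces the sums to be finite, since a bare ring has no limits. The
-- iteration closes up because δₖ₊₁ = (1 - t)δₖ + tu: at U = u/δₖ the kernel root is V = δₖ/δₖ₊₁, so
-- UV = u/δₖ₊₁ and the factors V telescope. Nothing is divided by 1 - v or by t: the former is kept
-- as a factor, the latter is cancelled because multiplication by t is injective. The only inverses
-- are those of the denominators δₛγ₁⋯γₛ₊₁, whose constant term is 1. At a fixed coefficient of u^a
-- t^n, m = a + 1 iterations and any N ≥ n make both remainders invisible. A separate argument
-- identifies the filtered list of words with a tree of states.

module ℤSolver {c ℓ} (R : CommutativeRing c ℓ) where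
  open CommutativeRing R
  open RingProperties ring
  open Mult semiring using (×-homo-+; ×1-homo-*) renaming (_×_ to _×′_)
  open SetoidReasoning setoid

  -- Equality in `R` need not be decidable, and for series it is not. Integer coefficients have
  -- decidable equality, which lets the solver cancel terms while normalising.
  ⟦_⟧ℤ : ℤ → Carrier
  ⟦ + n      ⟧ℤ = n ×′ 1#
  ⟦ -[1+ n ] ⟧ℤ = - (suc n ×′ 1#)

  private
    cancel-middle : ∀ x y z → (x + y) - (x + z) ≈ y - z
    cancel-middle x y z = begin
      (x + y) - (x + z)       ≈⟨ +-cong (+-comm x y) (sym (-‿+-comm x z)) ⟩
      (y + x) + (- x + - z)   ≈⟨ +-assoc y x _ ⟩
      y + (x + (- x + - z))   ≈⟨ +-congˡ (+-assoc x (- x) (- z)) ⟨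
      y + ((x - x) + - z)     ≈⟨ +-congˡ (+-congʳ (-‿inverseʳ x)) ⟩
      y + (0# + - z)          ≈⟨ +-congˡ (+-identityˡ (- z)) ⟩
      y - z                   ∎

    ⊖-homo : ∀ m n → ⟦ m ℤ.⊖ n ⟧ℤ ≈ m ×′ 1# - n ×′ 1#
    ⊖-homo m zero = sym (trans (+-congˡ -0#≈0#) (+-identityʳ _))
    ⊖-homo zero (suc n) = sym (+-identityˡ _)
    ⊖-homo (suc m) (suc n) = begin
      ⟦ suc m ℤ.⊖ suc n ⟧ℤ           ≡⟨ ≡.cong ⟦_⟧ℤ (ℤP.[1+m]⊖[1+n]≡m⊖n m n) ⟩
      ⟦ m ℤ.⊖ n ⟧ℤ                   ≈⟨ ⊖-homo m n ⟩
      m ×′ 1# - n ×′ 1#                ≈⟨ cancel-middle 1# (m ×′ 1#) (n ×′ 1#) ⟨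
      (1# + m ×′ 1#) - (1# + n ×′ 1#)  ≈⟨ +-cong (×-homo-+ 1# 1 m) (-‿cong (×-homo-+ 1# 1 n)) ⟨
      suc m ×′ 1# - suc n ×′ 1#        ∎

    neg-homo : ∀ i → ⟦ ℤ.- i ⟧ℤ ≈ - ⟦ i ⟧ℤ
    neg-homo (+ zero)  = sym -0#≈0#
    neg-homo (+ suc n) = refl
    neg-homo -[1+ n ]  = sym (-‿involutive _)

    add-homo : ∀ i j → ⟦ i ℤ.+ j ⟧ℤ ≈ ⟦ i ⟧ℤ + ⟦ j ⟧ℤ
    add-homo (+ m)    (+ n)    = ×-homo-+ 1# m n
    add-homo (+ m)    -[1+ n ] = ⊖-homo m (suc n)
    add-homo -[1+ m ] (+ n)    = trans (⊖-homo n (suc m)) (+-comm _ _)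
    add-homo -[1+ m ] -[1+ n ] = begin
      - (suc (suc (m ℕ.+ n)) ×′ 1#)        ≡⟨ ≡.cong (λ k → - (k ×′ 1#)) (≡.sym (≡.cong suc (ℕP.+-suc m n))) ⟩
      - ((suc m ℕ.+ suc n) ×′ 1#)          ≈⟨ -‿cong (×-homo-+ 1# (suc m) (suc n)) ⟩
      - (suc m ×′ 1# + suc n ×′ 1#)         ≈⟨ -‿+-comm _ _ ⟨
      - (suc m ×′ 1#) + - (suc n ×′ 1#)     ∎

    mul-homo⁺ : ∀ m j → ⟦ + m ℤ.* j ⟧ℤ ≈ ⟦ + m ⟧ℤ * ⟦ j ⟧ℤ
    mul-homo⁺ m (+ n) = trans (reflexive (≡.cong ⟦_⟧ℤ (≡.sym (ℤP.pos-* m n)))) (×1-homo-* m n)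
    mul-homo⁺ m -[1+ n ] = begin
      ⟦ + m ℤ.* -[1+ n ] ⟧ℤ           ≡⟨ ≡.cong ⟦_⟧ℤ (ℤP.neg-distribʳ-* (+ m) (+ suc n)) ⟨
      ⟦ ℤ.- (+ m ℤ.* + suc n) ⟧ℤ      ≈⟨ neg-homo (+ m ℤ.* + suc n) ⟩
      - ⟦ + m ℤ.* + suc n ⟧ℤ          ≈⟨ -‿cong (mul-homo⁺ m (+ suc n)) ⟩
      - (m ×′ 1# * suc n ×′ 1#)         ≈⟨ -‿distribʳ-* _ _ ⟩
      m ×′ 1# * - (suc n ×′ 1#)         ∎

    mul-homo : ∀ i j → ⟦ i ℤ.* j ⟧ℤ ≈ ⟦ i ⟧ℤ * ⟦ j ⟧ℤ
    mul-homo (+ m) j = mul-homo⁺ m j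
    mul-homo -[1+ m ] j = begin
      ⟦ -[1+ m ] ℤ.* j ⟧ℤ           ≡⟨ ≡.cong ⟦_⟧ℤ (ℤP.neg-distribˡ-* (+ suc m) j) ⟨
      ⟦ ℤ.- (+ suc m ℤ.* j) ⟧ℤ      ≈⟨ neg-homo (+ suc m ℤ.* j) ⟩
      - ⟦ + suc m ℤ.* j ⟧ℤ          ≈⟨ -‿cong (mul-homo⁺ (suc m) j) ⟩
      - (suc m ×′ 1# * ⟦ j ⟧ℤ)       ≈⟨ -‿distribˡ-* _ _ ⟩
      - (suc m ×′ 1#) * ⟦ j ⟧ℤ       ∎

    morphism : CommutativeRing.rawRing ℤP.+-*-commutativeRing
               -Raw-AlmostCommutative⟶ fromCommutativeRing R
    morphism = record
      { ⟦_⟧ = ⟦_⟧ℤ ; +-homo = add-homo ; *-homo = mul-homo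
      ; -‿homo = neg-homo ; 0-homo = refl ; 1-homo = refl }

    dec : ∀ i j → Maybe (⟦ i ⟧ℤ ≈ ⟦ j ⟧ℤ)
    dec i j with i ℤ.≟ j
    ... | yes ≡.refl = just refl
    ... | no _       = nothing

  open RingSolver _ _ morphism dec public
    using (Polynomial; solve; _:=_; _:+_; _:*_; _:-_; :-_; con)

-- Formal power series

module Sums {c ℓ} (R : CommutativeRing c ℓ) where
  open CommutativeRing R

  ∑ : ℕ → (ℕ → Carrier) → Carrier
  ∑ zero    f = 0#
  ∑ (suc n) f = ∑ n f + f n

  ∑-cong : ∀ n {f g} → (∀ i → i ℕ.< n → f i ≈ g i) → ∑ n f ≈ ∑ n g
  ∑-cong zero    e = refl
  ∑-cong (suc n) e = +-cong (∑-cong n λ i i<n → e i (ℕP.m<n⇒m<1+n i<n)) (e n ℕP.≤-refl)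

  ∑-head : ∀ n f → ∑ (suc n) f ≈ f 0 + ∑ n (f ∘ suc)
  ∑-head zero    f = +-comm _ _
  ∑-head (suc n) f = trans (+-congʳ (∑-head n f)) (+-assoc _ _ _)

module PowerSeries {c ℓ} (R : CommutativeRing c ℓ) where
  open CommutativeRing R
  open SetoidReasoning setoid
  open Sums R

  infixl 7 _✶_

  -- The Cauchy product, by recursion on the left factor: in this form the ring laws are plain
  -- inductions, and `✶-sum` recovers the usual convolution.
  _✶_ : (ℕ → Carrier) → (ℕ → Carrier) → ℕ → Carrier
  (f ✶ g) zero    = f 0 * g 0
  (f ✶ g) (suc n) = f 0 * g (suc n) + (f ∘ suc ✶ g) n

  ✶-sum : ∀ f g n → (f ✶ g) n ≈ ∑ (suc n) (λ i → f i * g (n ∸ i))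
  ✶-sum f g zero    = sym (+-identityˡ _)
  ✶-sum f g (suc n) = begin
    f 0 * g (suc n) + (f ∘ suc ✶ g) n                              ≈⟨ +-congˡ (✶-sum (f ∘ suc) g n) ⟩
    f 0 * g (suc n) + ∑ (suc n) (λ i → f (suc i) * g (n ∸ i))      ≈⟨ ∑-head (suc n) (λ i → f i * g (suc n ∸ i)) ⟨
    ∑ (suc (suc n)) (λ i → f i * g (suc n ∸ i))                    ∎

  ✶-cong : ∀ {f f′ g g′} → (∀ n → f n ≈ f′ n) → (∀ n → g n ≈ g′ n) → ∀ n → (f ✶ g) n ≈ (f′ ✶ g′) n
  ✶-cong p q zero    = *-cong (p 0) (q 0)
  ✶-cong p q (suc n) = +-cong (*-cong (p 0) (q (suc n))) (✶-cong (p ∘ suc) q n)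

  ✶-distribʳ : ∀ h f g n → ((λ i → f i + g i) ✶ h) n ≈ (f ✶ h) n + (g ✶ h) n
  ✶-distribʳ h f g zero    = distribʳ _ _ _
  ✶-distribʳ h f g (suc n) = begin
    (f 0 + g 0) * h (suc n) + ((λ i → f (suc i) + g (suc i)) ✶ h) n
      ≈⟨ +-cong (distribʳ _ _ _) (✶-distribʳ h (f ∘ suc) (g ∘ suc) n) ⟩
    (f 0 * h (suc n) + g 0 * h (suc n)) + ((f ∘ suc ✶ h) n + (g ∘ suc ✶ h) n)
      ≈⟨ interchange +-commutativeSemigroup _ _ _ _ ⟩
    (f ✶ h) (suc n) + (g ✶ h) (suc n) ∎

  ✶-suc : ∀ f g n → (f ✶ g) (suc n) ≈ g 0 * f (suc n) + (f ✶ g ∘ suc) n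
  ✶-suc f g zero    = trans (+-comm _ _) (+-congʳ (*-comm _ _))
  ✶-suc f g (suc n) = begin
    f 0 * g (2 ℕ.+ n) + (f ∘ suc ✶ g) (suc n)
      ≈⟨ +-congˡ (✶-suc (f ∘ suc) g n) ⟩
    f 0 * g (2 ℕ.+ n) + (g 0 * f (2 ℕ.+ n) + (f ∘ suc ✶ g ∘ suc) n)
      ≈⟨ x∙yz≈y∙xz +-commutativeSemigroup _ _ _ ⟩
    g 0 * f (2 ℕ.+ n) + (f 0 * g (2 ℕ.+ n) + (f ∘ suc ✶ g ∘ suc) n) ∎

  ✶-comm : ∀ f g n → (f ✶ g) n ≈ (g ✶ f) n
  ✶-comm f g zero    = *-comm _ _
  ✶-comm f g (suc n) = trans (+-congˡ (✶-comm (f ∘ suc) g n)) (sym (✶-suc g f n))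

  ✶-scale : ∀ x f g n → ((λ i → x * f i) ✶ g) n ≈ x * (f ✶ g) n
  ✶-scale x f g zero    = *-assoc _ _ _
  ✶-scale x f g (suc n) = trans (+-cong (*-assoc _ _ _) (✶-scale x (f ∘ suc) g n)) (sym (distribˡ _ _ _))

  ✶-assoc : ∀ f g h n → ((f ✶ g) ✶ h) n ≈ (f ✶ (g ✶ h)) n
  ✶-assoc f g h zero    = *-assoc _ _ _
  ✶-assoc f g h (suc n) = begin
    f 0 * g 0 * h (suc n) + ((λ i → f 0 * g (suc i) + (f ∘ suc ✶ g) i) ✶ h) n
      ≈⟨ +-cong (*-assoc _ _ _) (✶-distribʳ h _ _ n) ⟩
    f 0 * (g 0 * h (suc n)) + (((λ i → f 0 * g (suc i)) ✶ h) n + ((f ∘ suc ✶ g) ✶ h) n)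
      ≈⟨ +-congˡ (+-cong (✶-scale (f 0) (g ∘ suc) h n) (✶-assoc (f ∘ suc) g h n)) ⟩
    f 0 * (g 0 * h (suc n)) + (f 0 * (g ∘ suc ✶ h) n + (f ∘ suc ✶ (g ✶ h)) n)
      ≈⟨ +-assoc _ _ _ ⟨
    f 0 * (g 0 * h (suc n)) + f 0 * (g ∘ suc ✶ h) n + (f ∘ suc ✶ (g ✶ h)) n
      ≈⟨ +-congʳ (distribˡ _ _ _) ⟨
    (f ✶ (g ✶ h)) (suc n) ∎

  𝟙 : ℕ → Carrier
  𝟙 zero    = 1#
  𝟙 (suc _) = 0#

  ✶-zeroˡ : ∀ g n → ((λ _ → 0#) ✶ g) n ≈ 0#
  ✶-zeroˡ g zero    = zeroˡ _
  ✶-zeroˡ g (suc n) = trans (+-cong (zeroˡ _) (✶-zeroˡ g n)) (+-identityˡ _)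

  ✶-identityˡ : ∀ g n → (𝟙 ✶ g) n ≈ g n
  ✶-identityˡ g zero    = *-identityˡ _
  ✶-identityˡ g (suc n) = trans (+-cong (*-identityˡ _) (✶-zeroˡ g n)) (+-identityʳ _)

  powerSeries : CommutativeRing c ℓ
  powerSeries = record
    { Carrier = ℕ → Carrier
    ; _≈_ = λ f g → ∀ n → f n ≈ g n
    ; _+_ = λ f g n → f n + g n
    ; _*_ = _✶_
    ; -_  = λ f n → - f n
    ; 0#  = λ _ → 0#
    ; 1#  = 𝟙
    ; isCommutativeRing = record
      { isRing = record
        { +-isAbelianGroup = record
          { isGroup = record
            { isMonoid = record
              { isSemigroup = record
                { isMagma = record
                  { isEquivalence = record
                    { refl = λ _ → refl ; sym = λ p n → sym (p n) ; trans = λ p q n → trans (p n) (q n) }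
                  ; ∙-cong = λ p q n → +-cong (p n) (q n) }
                ; assoc = λ f g h n → +-assoc _ _ _ }
              ; identity = (λ f n → +-identityˡ _) , (λ f n → +-identityʳ _) }
            ; inverse = (λ f n → -‿inverseˡ _) , (λ f n → -‿inverseʳ _)
            ; ⁻¹-cong = λ p n → -‿cong (p n) }
          ; comm = λ f g n → +-comm _ _ }
        ; *-cong = ✶-cong
        ; *-assoc = ✶-assoc
        ; *-identity = ✶-identityˡ , (λ f n → trans (✶-comm f 𝟙 n) (✶-identityˡ f n))
        ; distrib = (λ h f g n → trans (✶-comm h _ n) (trans (✶-distribʳ h f g n)
                       (+-cong (✶-comm f h n) (✶-comm g h n))))
                  , ✶-distribʳ }
      ; *-comm = ✶-comm } }

ℤ-ring ℤ[T] ℤ[Z,T] ℤ[U,Z,T] : CommutativeRing _ _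
ℤ-ring   = ℤP.+-*-commutativeRing
ℤ[T]     = PowerSeries.powerSeries ℤ-ring
ℤ[Z,T]   = PowerSeries.powerSeries ℤ[T]
ℤ[U,Z,T] = PowerSeries.powerSeries ℤ[Z,T]

sumTo-cong : ∀ n {f g : ℕ → ℤ} → (∀ i → i ℕ.< n → f i ≡ g i) → sumTo n f ≡ sumTo n g
sumTo-cong zero    e = ≡.refl
sumTo-cong (suc n) e = ≡.cong₂ ℤ._+_ (sumTo-cong n λ i i<n → e i (ℕP.m<n⇒m<1+n i<n)) (e n ℕP.≤-refl)

sumTo-∑ : ∀ n f → Sums.∑ ℤ-ring n f ≡ sumTo n f
sumTo-∑ zero    f = ≡.refl
sumTo-∑ (suc n) f = ≡.cong (ℤ._+ f n) (sumTo-∑ n f)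

-- A convolution over triples of exponents is a convolution in U whose coefficients are convolved in
-- Z, and theirs in T. The ring laws can thus be transported from the nested power series ring
-- without handling triple sums.
⊛-✶ : ∀ f g → CommutativeRing._≈_ ℤ[U,Z,T] (f ⊛ g) (CommutativeRing._*_ ℤ[U,Z,T] f g)
⊛-✶ f g a b c = ≡.sym (begin
  (f U.✶ g) a b c
    ≡⟨ U.✶-sum f g a b c ⟩
  Sums.∑ ℤ[Z,T] (suc a) (λ i → f i Z.✶ g (a ∸ i)) b c
    ≡⟨ ∑-at₂ (suc a) (λ i → f i Z.✶ g (a ∸ i)) ⟩
  sumTo (suc a) (λ i → (f i Z.✶ g (a ∸ i)) b c)
    ≡⟨ sumTo-cong (suc a) (λ i _ → ≡.trans (Z.✶-sum (f i) (g (a ∸ i)) b c)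
         (≡.trans (∑-at (suc b) (λ j → f i j T.✶ g (a ∸ i) (b ∸ j)))
           (sumTo-cong (suc b) λ j _ → ≡.trans (T.✶-sum (f i j) (g (a ∸ i) (b ∸ j)) c)
             (sumTo-∑ (suc c) (λ k → f i j k ℤ.* g (a ∸ i) (b ∸ j) (c ∸ k)))))) ⟩
  (f ⊛ g) a b c ∎)
  where
  open ≡.≡-Reasoning
  module T = PowerSeries ℤ-ring
  module Z = PowerSeries ℤ[T]
  module U = PowerSeries ℤ[Z,T]
  ∑-at : ∀ n F → Sums.∑ ℤ[T] n F c ≡ sumTo n (λ i → F i c)
  ∑-at zero    F = ≡.refl
  ∑-at (suc n) F = ≡.cong (ℤ._+ F n c) (∑-at n F)
  ∑-at₂ : ∀ n F → Sums.∑ ℤ[Z,T] n F b c ≡ sumTo n (λ i → F i b c)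
  ∑-at₂ zero    F = ≡.refl
  ∑-at₂ (suc n) F = ≡.cong (ℤ._+ F n b c) (∑-at₂ n F)

one-𝟙 : CommutativeRing._≈_ ℤ[U,Z,T] one (CommutativeRing.1# ℤ[U,Z,T])
one-𝟙 zero    zero    zero    = ≡.refl
one-𝟙 zero    zero    (suc c) = ≡.refl
one-𝟙 zero    (suc b) c       = ≡.refl
one-𝟙 (suc a) b       c       = ≡.refl

infix 4 _≋_

-- Being a record, _≋_ does not unfold, so its arguments can be inferred.
record _≋_ (f g : Series) : Set where
  constructor wrap
  field at : ∀ a b c → f a b c ≡ g a b c
open _≋_ public

⊖-_ : Series → Series
(⊖- f) a b c = ℤ.- f a b c

-- Opaque, so that the transported proofs are never unfolded.
abstract
  isSeriesRing : IsCommutativeRing _≋_ _⊕_ _⊛_ ⊖-_ (λ _ _ _ → + 0) one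
  isSeriesRing = record
    { isRing = record
      { +-isAbelianGroup = record
        { isGroup = record
          { isMonoid = record
            { isSemigroup = record
              { isMagma = record
                { isEquivalence = record
                  { refl = wrap refl
                  ; sym = λ p → wrap (sym (at p))
                  ; trans = λ p q → wrap (trans (at p) (at q)) }
                ; ∙-cong = λ p q → wrap (+-cong (at p) (at q)) }
              ; assoc = λ f g h → wrap (+-assoc f g h) }
            ; identity = (λ f → wrap (+-identityˡ f)) , (λ f → wrap (+-identityʳ f)) }
          ; inverse = (λ f → wrap (-‿inverseˡ f)) , (λ f → wrap (-‿inverseʳ f))
          ; ⁻¹-cong = λ p → wrap (-‿cong (at p)) }
        ; comm = λ f g → wrap (+-comm f g) }
      ; *-cong = ⊛-cong
      ; *-assoc = ⊛-assoc
      ; *-identity = ⊛-identityˡ , (λ f → ≋-trans (⊛-comm f one) (⊛-identityˡ f))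
      ; distrib = (λ f g h → ≋-trans (⊛-comm f (g ⊕ h)) (≋-trans (⊛-distribʳ f g h)
                     (wrap (+-cong (at (⊛-comm g f)) (at (⊛-comm h f))))))
                , ⊛-distribʳ }
    ; *-comm = ⊛-comm }
    where
    open CommutativeRing ℤ[U,Z,T]
    ≋-trans : ∀ {f g h} → f ≋ g → g ≋ h → f ≋ h
    ≋-trans p q = wrap (trans (at p) (at q))
    ⊛-cong : ∀ {f f′ g g′} → f ≋ f′ → g ≋ g′ → f ⊛ g ≋ f′ ⊛ g′
    ⊛-cong {f} {f′} {g} {g′} p q =
      wrap (trans (⊛-✶ f g) (trans (*-cong (at p) (at q)) (sym (⊛-✶ f′ g′))))
    ⊛-comm : ∀ f g → f ⊛ g ≋ g ⊛ f
    ⊛-comm f g = wrap (trans (⊛-✶ f g) (trans (*-comm f g) (sym (⊛-✶ g f))))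
    ⊛-assoc : ∀ f g h → (f ⊛ g) ⊛ h ≋ f ⊛ (g ⊛ h)
    ⊛-assoc f g h = wrap (trans (trans (⊛-✶ (f ⊛ g) h) (*-cong (⊛-✶ f g) (refl {h})))
      (trans (*-assoc f g h) (sym (trans (⊛-✶ f (g ⊛ h)) (*-cong (refl {f}) (⊛-✶ g h))))))
    ⊛-identityˡ : ∀ f → one ⊛ f ≋ f
    ⊛-identityˡ f = wrap (trans (⊛-✶ one f) (trans (*-cong one-𝟙 (refl {f})) (*-identityˡ f)))
    ⊛-distribʳ : ∀ f g h → (g ⊕ h) ⊛ f ≋ g ⊛ f ⊕ h ⊛ f
    ⊛-distribʳ f g h = wrap (trans (⊛-✶ (g ⊕ h) f)
      (trans (distribʳ f g h) (sym (+-cong (⊛-✶ g f) (⊛-✶ h f)))))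

seriesRing : CommutativeRing _ _
seriesRing = record { isCommutativeRing = isSeriesRing }

-- The kernel method

-- (ascents, last entry, zeros) of a nonempty ascent sequence.
State : Set
State = ℕ × ℕ × ℕ

isZero : ℕ → ℕ
isZero zero    = 1
isZero (suc _) = 0

next : State → ℕ → State
next (a , l , b) x = (if l <ᵇ x then 1 else 0) ℕ.+ a , x , isZero x ℕ.+ b

Valid : State → Set
Valid (a , l , b) = l ≤ a

next-weak : ∀ {l x} → x ≤ l → (if l <ᵇ x then 1 else 0) ≡ 0
next-weak {l} {x} x≤l with l <ᵇ x | ℕP.<ᵇ⇒< l x
... | false | _ = ≡.refl
... | true  | l<x = contradiction (l<x _) (ℕP.≤⇒≯ x≤l)

next-ascent : ∀ {l x} → l < x → (if l <ᵇ x then 1 else 0) ≡ 1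
next-ascent {l} {x} l<x with l <ᵇ x | ℕP.<⇒<ᵇ l<x
... | true | _ = ≡.refl

next-valid : ∀ s x → Valid s → x < 2 ℕ.+ proj₁ s → Valid (next s x)
next-valid (a , l , b) x l≤a (s≤s x≤1+a) with ℕP.≤-<-connex x l
... | inj₁ x≤l rewrite next-weak x≤l = ℕP.≤-trans x≤l l≤a
... | inj₂ l<x rewrite next-ascent l<x = x≤1+a

-- Stated over any ring, because the same tree is summed with values in series and, after extracting
-- a coefficient, with values in ℤ.
module Tree {c ℓ} (R : CommutativeRing c ℓ) where
  open CommutativeRing R
  open Sums R public

  step : (State → Carrier) → State → Carrier
  step f s = ∑ (2 ℕ.+ proj₁ s) (λ x → f (next s x))

  -- The sum of f over the states reached by appending k letters.
  walks : (State → Carrier) → ℕ → State → Carrier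
  walks f zero    = f
  walks f (suc k) = step (walks f k)

  step-cong : ∀ {f g} → (∀ s → Valid s → f s ≈ g s) → ∀ s → Valid s → step f s ≈ step g s
  step-cong e s v = ∑-cong (2 ℕ.+ proj₁ s) λ x x< → e (next s x) (next-valid s x v x<)

  walks-cong : ∀ k {f g} → (∀ s → Valid s → f s ≈ g s) → ∀ s → Valid s → walks f k s ≈ walks g k s
  walks-cong zero    e = e
  walks-cong (suc k) e = step-cong (walks-cong k e)

  -- `walks` branches on the first appended letter, whereas the weight recurrence describes the last
  -- one; this moves a step from the root to the leaves.
  walks-step : ∀ k f s → Valid s → walks f (suc k) s ≈ walks (step f) k s
  walks-step zero    f s v = refl
  walks-step (suc k) f s v = step-cong (walks-step k f) s v

  ∑-+ : ∀ n f g → ∑ n (λ i → f i + g i) ≈ ∑ n f + ∑ n g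
  ∑-+ zero    f g = sym (+-identityˡ _)
  ∑-+ (suc n) f g = trans (+-congʳ (∑-+ n f g)) (interchange +-commutativeSemigroup _ _ _ _)

  ∑-* : ∀ n x f → ∑ n (λ i → x * f i) ≈ x * ∑ n f
  ∑-* zero    x f = sym (zeroʳ x)
  ∑-* (suc n) x f = trans (+-congʳ (∑-* n x f)) (sym (distribˡ _ _ _))

  ∑-++ : ∀ m n f → ∑ (m ℕ.+ n) f ≈ ∑ m f + ∑ n (λ i → f (m ℕ.+ i))
  ∑-++ m zero    f rewrite ℕP.+-identityʳ m = sym (+-identityʳ _)
  ∑-++ m (suc n) f rewrite ℕP.+-suc m n = trans (+-congʳ (∑-++ m n f)) (+-assoc _ _ _)

  walks-+ : ∀ k f g s → Valid s → walks (λ s → f s + g s) k s ≈ walks f k s + walks g k s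
  walks-+ zero    f g s v = refl
  walks-+ (suc k) f g s v = trans (step-cong (walks-+ k f g) s v) (∑-+ (2 ℕ.+ proj₁ s) _ _)

  walks-* : ∀ k x f s → Valid s → walks (λ s → x * f s) k s ≈ x * walks f k s
  walks-* zero    x f s v = refl
  walks-* (suc k) x f s v = trans (step-cong (walks-* k x f) s v) (∑-* (2 ℕ.+ proj₁ s) x _)

Cancellable : ∀ {c ℓ} (R : CommutativeRing c ℓ) → CommutativeRing.Carrier R → Set _
Cancellable R t = ∀ x y → t * x ≈ t * y → x ≈ y
  where open CommutativeRing R

-- The functional equation and its kernel

module KernelMethod {c ℓ} (R : CommutativeRing c ℓ)
  (z t : CommutativeRing.Carrier R) (t-cancel : Cancellable R t) where

  open CommutativeRing R
  open SetoidReasoning setoid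
  open Tree R
  open Exp commutativeSemiring using (_^_; ^-congˡ; ^-homo-*; ^-distrib-*)
  open ℤSolver R

  𝟏 : ∀ {n} → Polynomial n
  𝟏 {n} = con {n} (+ 1)

  𝟎 : ∀ {n} → Polynomial n
  𝟎 {n} = con {n} (+ 0)

  weight : Carrier → Carrier → State → Carrier
  weight U V (a , l , b) = U ^ a * V ^ l * z ^ b

  1^n≈1 : ∀ n → 1# ^ n ≈ 1#
  1^n≈1 zero    = refl
  1^n≈1 (suc n) = trans (*-identityˡ _) (1^n≈1 n)

  geometric : ∀ V m n → (1# - V) * ∑ n (λ i → V ^ (m ℕ.+ i)) ≈ V ^ m - V ^ (m ℕ.+ n)
  geometric V m zero rewrite ℕP.+-identityʳ m = trans (zeroʳ _) (sym (-‿inverseʳ _))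
  geometric V m (suc n) rewrite ℕP.+-suc m n = begin
    (1# - V) * (∑ n (λ i → V ^ (m ℕ.+ i)) + W)
      ≈⟨ distribˡ _ _ _ ⟩
    (1# - V) * ∑ n (λ i → V ^ (m ℕ.+ i)) + (1# - V) * W
      ≈⟨ +-congʳ (geometric V m n) ⟩
    (V ^ m - W) + (1# - V) * W
      ≈⟨ solve 3 (λ A V W → (A :- W) :+ (𝟏 :- V) :* W := A :- V :* W) refl (V ^ m) V W ⟩
    V ^ m - V * W ∎
    where W = V ^ (m ℕ.+ n)

  -- The a + 2 admissible letters split into 0, which alone gains a factor z, then 1, ..., l without
  -- ascent, and l + 1, ..., a + 1 with one. The last two ranges are geometric sums in V, cleared of
  -- denominators by 1 - V. Their top term U^(a+1) V^(a+2) equals UV² (UV)^a, which is how the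
  -- weight at UV arises.
  step-weight : ∀ U V s → Valid s →
    (1# - V) * step (weight U V) s
      ≈ (z * (1# - V) + V) * weight U 1# s + ((U - 1#) * V) * weight U V s
        + (- (U * V * V)) * weight (U * V) 1# s
  step-weight U V s@(a , l , b) l≤a = begin
    (1# - V) * ∑ (2 ℕ.+ a) g
      ≡⟨ ≡.cong (λ n → (1# - V) * ∑ n g) 2+a ⟩
    (1# - V) * ∑ (suc l ℕ.+ suc d) g
      ≈⟨ *-congˡ (trans (∑-++ (suc l) (suc d) g) (+-congʳ (∑-head l g))) ⟩
    (1# - V) * ((g 0 + ∑ l (g ∘ suc)) + ∑ (suc d) (λ i → g (suc l ℕ.+ i)))
      ≈⟨ *-congˡ (+-cong (+-congˡ weak) ascending) ⟩
    (1# - V) * ((g 0 + (A * B) * G₁) + (U * A * B) * G₂)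
      ≈⟨ solve 7 (λ V g₀ A B U G₁ G₂ →
           (𝟏 :- V) :* ((g₀ :+ (A :* B) :* G₁) :+ (U :* A :* B) :* G₂)
           := (𝟏 :- V) :* g₀ :+ (A :* B) :* ((𝟏 :- V) :* G₁) :+ (U :* A :* B) :* ((𝟏 :- V) :* G₂))
           refl V (g 0) A B U G₁ G₂ ⟩
    (1# - V) * g 0 + (A * B) * ((1# - V) * G₁) + (U * A * B) * ((1# - V) * G₂)
      ≈⟨ +-cong (+-congˡ (*-congˡ (geometric V 1 l))) (*-congˡ (geometric V (suc l) (suc d))) ⟩
    (1# - V) * (A * 1# * (z * B)) + (A * B) * (V * 1# - V * L) + (U * A * B) * (V * L - V ^ (suc l ℕ.+ suc d))
      ≡⟨ ≡.cong (λ n → (1# - V) * (A * 1# * (z * B)) + (A * B) * (V * 1# - V * L) + (U * A * B) * (V * L - V ^ n)) 2+a ⟨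
    (1# - V) * (A * 1# * (z * B)) + (A * B) * (V * 1# - V * L) + (U * A * B) * (V * L - V * (V * M))
      ≈⟨ solve 7 (λ V A z B U L M →
           (𝟏 :- V) :* (A :* 𝟏 :* (z :* B)) :+ (A :* B) :* (V :* 𝟏 :- V :* L) :+ (U :* A :* B) :* (V :* L :- V :* (V :* M))
           := (z :* (𝟏 :- V) :+ V) :* (A :* 𝟏 :* B) :+ ((U :- 𝟏) :* V) :* (A :* L :* B)
              :+ (:- (U :* V :* V)) :* ((A :* M) :* 𝟏 :* B))
           refl V A z B U L M ⟩
    (z * (1# - V) + V) * (A * 1# * B) + ((U - 1#) * V) * (A * L * B)
      + (- (U * V * V)) * ((A * M) * 1# * B)
      ≈⟨ +-cong (+-congʳ (*-congˡ (*-congʳ (*-congˡ (sym (1^n≈1 l))))))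
                (*-congˡ (*-congʳ (*-cong (sym (^-distrib-* U V a)) (sym (1^n≈1 l))))) ⟩
    (z * (1# - V) + V) * weight U 1# s + ((U - 1#) * V) * weight U V s
      + (- (U * V * V)) * weight (U * V) 1# s ∎
    where
    d = a ∸ l
    A = U ^ a
    B = z ^ b
    L = V ^ l
    M = V ^ a
    g = λ x → weight U V (next s x)
    G₁ = ∑ l (λ i → V ^ (1 ℕ.+ i))
    G₂ = ∑ (suc d) (λ i → V ^ (suc l ℕ.+ i))
    2+a : 2 ℕ.+ a ≡ suc l ℕ.+ suc d
    2+a = ≡.cong suc (≡.sym (≡.trans (ℕP.+-suc l d) (≡.cong suc (ℕP.m+[n∸m]≡n l≤a))))
    weak : ∑ l (g ∘ suc) ≈ (A * B) * G₁
    weak = trans (∑-cong l h) (∑-* l (A * B) _)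
      where
      h : ∀ i → i < l → g (suc i) ≈ (A * B) * V ^ (1 ℕ.+ i)
      h i i<l rewrite next-weak i<l = solve 3 (λ A B C → A :* C :* B := (A :* B) :* C) refl A B (V ^ suc i)
    ascending : ∑ (suc d) (λ i → g (suc l ℕ.+ i)) ≈ (U * A * B) * G₂
    ascending = trans (∑-cong (suc d) h) (∑-* (suc d) (U * A * B) _)
      where
      h : ∀ i → i < suc d → g (suc l ℕ.+ i) ≈ (U * A * B) * V ^ (suc l ℕ.+ i)
      h i _ rewrite next-ascent (s≤s (ℕP.m≤m+n l i)) =
        solve 3 (λ A B C → A :* C :* B := (A :* B) :* C) refl (U * A) B (V ^ (suc l ℕ.+ i))

  -- Ascent sequences of length n + 1 start from the one-letter sequence (0).
  level : ℕ → Carrier → Carrier → Carrier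
  level n U V = walks (weight U V) n (0 , 0 , 1)

  level-suc : ∀ n U V → (1# - V) * level (suc n) U V
    ≈ (z * (1# - V) + V) * level n U 1# + ((U - 1#) * V) * level n U V
      + (- (U * V * V)) * level n (U * V) 1#
  level-suc n U V = begin
    (1# - V) * walks (weight U V) (suc n) s₀
      ≈⟨ *-congˡ (walks-step n (weight U V) s₀ z≤n) ⟩
    (1# - V) * walks (step (weight U V)) n s₀
      ≈⟨ walks-* n (1# - V) (step (weight U V)) s₀ z≤n ⟨
    walks (λ s → (1# - V) * step (weight U V) s) n s₀
      ≈⟨ walks-cong n (step-weight U V) s₀ z≤n ⟩
    walks (λ s → (z * (1# - V) + V) * weight U 1# s + ((U - 1#) * V) * weight U V s
        + (- (U * V * V)) * weight (U * V) 1# s) n s₀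
      ≈⟨ walks-+ n _ _ s₀ z≤n ⟩
    walks (λ s → (z * (1# - V) + V) * weight U 1# s + ((U - 1#) * V) * weight U V s) n s₀
      + walks (λ s → (- (U * V * V)) * weight (U * V) 1# s) n s₀
      ≈⟨ +-cong (trans (walks-+ n _ _ s₀ z≤n)
                       (+-cong (walks-* n _ _ s₀ z≤n) (walks-* n _ _ s₀ z≤n)))
                (walks-* n _ _ s₀ z≤n) ⟩
    (z * (1# - V) + V) * level n U 1# + ((U - 1#) * V) * level n U V
      + (- (U * V * V)) * level n (U * V) 1# ∎
    where
    s₀ : State
    s₀ = 0 , 0 , 1

  truncated : ℕ → Carrier → Carrier → Carrier
  truncated N U V = ∑ N (λ n → t ^ suc n * level n U V)

  truncated-cong : ∀ N V {U U′} → U ≈ U′ → truncated N U V ≈ truncated N U′ V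
  truncated-cong N V e = ∑-cong N λ n _ → *-congˡ
    (walks-cong n (λ { (a , l , b) _ → *-congʳ (*-congʳ (^-congˡ a e)) }) (0 , 0 , 1) z≤n)

  -- `level-suc` summed against powers of t. Level 0 gives the term tz; appending a letter to levels
  -- 0, ..., N - 1 gives levels 1, ..., N, so the left-hand side holds one level more than
  -- `truncated N`.
  truncated-recurrence : ∀ N U V →
    (1# - V) * (truncated N U V + t ^ suc N * level N U V)
      ≈ (1# - V) * (t * z)
        + t * ((z * (1# - V) + V) * truncated N U 1# + ((U - 1#) * V) * truncated N U V
               + (- (U * V * V)) * truncated N (U * V) 1#)
  truncated-recurrence zero U V = begin
    (1# - V) * (0# + t * 1# * (1# * 1# * (z * 1#)))
      ≈⟨ solve 5 (λ V t z α κ → (𝟏 :- V) :* (𝟎 :+ t :* 𝟏 :* (𝟏 :* 𝟏 :* (z :* 𝟏)))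
           := (𝟏 :- V) :* (t :* z) :+ t :* (α :* 𝟎 :+ V :* 𝟎 :+ κ :* 𝟎)) refl V t z 1# 1# ⟩
    (1# - V) * (t * z) + t * (1# * 0# + V * 0# + 1# * 0#)
      ≈⟨ +-congˡ (*-congˡ (+-cong (+-cong (all-zero _ _) (all-zero _ _)) (all-zero _ _))) ⟩
    (1# - V) * (t * z) + t * ((z * (1# - V) + V) * 0# + ((U - 1#) * V) * 0# + (- (U * V * V)) * 0#) ∎
    where
    all-zero : ∀ x y → x * 0# ≈ y * 0#
    all-zero x y = trans (zeroʳ x) (sym (zeroʳ y))
  truncated-recurrence (suc N) U V = begin
    (1# - V) * ((S + τ * h) + t * τ * h′)
      ≈⟨ solve 6 (λ V S τ h t h′ → (𝟏 :- V) :* ((S :+ τ :* h) :+ t :* τ :* h′)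
           := (𝟏 :- V) :* (S :+ τ :* h) :+ t :* τ :* ((𝟏 :- V) :* h′)) refl V S τ h t h′ ⟩
    (1# - V) * (S + τ * h) + t * τ * ((1# - V) * h′)
      ≈⟨ +-cong (truncated-recurrence N U V) (*-congˡ (level-suc N U V)) ⟩
    ((1# - V) * (t * z) + t * (α * S₁ + β * S + κ * S₂)) + t * τ * (α * h₁ + β * h + κ * h₂)
      ≈⟨ solve 12 (λ e t α β κ S₁ S S₂ τ h₁ h h₂ →
           (e :+ t :* (α :* S₁ :+ β :* S :+ κ :* S₂)) :+ t :* τ :* (α :* h₁ :+ β :* h :+ κ :* h₂)
           := e :+ t :* (α :* (S₁ :+ τ :* h₁) :+ β :* (S :+ τ :* h) :+ κ :* (S₂ :+ τ :* h₂)))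
           refl ((1# - V) * (t * z)) t α β κ S₁ S S₂ τ h₁ h h₂ ⟩
    (1# - V) * (t * z) + t * (α * (S₁ + τ * h₁) + β * (S + τ * h) + κ * (S₂ + τ * h₂)) ∎
    where
    α = z * (1# - V) + V
    β = (U - 1#) * V
    κ = - (U * V * V)
    τ = t ^ suc N
    S = truncated N U V
    S₁ = truncated N U 1#
    S₂ = truncated N (U * V) 1#
    h = level N U V
    h₁ = level N U 1#
    h₂ = level N (U * V) 1#
    h′ = level (suc N) U V

  -- The hypothesis says that V annihilates the kernel 1 − V + tV(1 − U). It also
  -- gives 1 − V = tV(U − 1), whence the common factor t that is cancelled.
  kernel-equation : ∀ N U V → V * (1# + t * (U - 1#)) ≈ 1# →
    (1# + z * t * (U - 1#)) * truncated N U 1#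
      ≈ (z * t * (1# - U) + U * V * truncated N (U * V) 1#)
        + t ^ suc N * ((U - 1#) * level N U V)
  kernel-equation N U V VK≈1 = t-cancel _ _ (begin
    t * ((1# + z * t * (U - 1#)) * S₁)
      -- A polynomial certificate: the difference of the two sides is a combination of rhs - lhs,
      -- zero by the recurrence, and 1 - VK, zero by hypothesis, with cofactors K and X.
      ≈⟨ solve 8 (λ t z U V S S₁ S₂ e →
           let K = 𝟏 :+ t :* (U :- 𝟏)
               rhs = (𝟏 :- V) :* (t :* z) :+ t :* ((z :* (𝟏 :- V) :+ V) :* S₁ :+ ((U :- 𝟏) :* V) :* S
                       :+ (:- (U :* V :* V)) :* S₂)
               lhs = (𝟏 :- V) :* (S :+ e)
               X = t :* ((𝟏 :- z) :* S₁ :+ (U :- 𝟏) :* S :- U :* V :* S₂) :+ S :+ e :- t :* z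
           in t :* ((𝟏 :+ z :* t :* (U :- 𝟏)) :* S₁)
              := t :* ((z :* t :* (𝟏 :- U) :+ U :* V :* S₂) :+ (U :- 𝟏) :* e)
                 :+ K :* (rhs :- lhs) :+ (𝟏 :- V :* K) :* X)
           refl t z U V S S₁ S₂ e ⟩
    t * ((z * t * (1# - U) + U * V * S₂) + (U - 1#) * e) + K * (rhs - lhs) + (1# - V * K) * X
      ≈⟨ +-cong (+-congˡ (*-congˡ (+-congˡ (-‿cong (truncated-recurrence N U V)))))
                (*-congʳ (+-congˡ (-‿cong VK≈1))) ⟩
    t * ((z * t * (1# - U) + U * V * S₂) + (U - 1#) * e) + K * (rhs - rhs) + (1# - 1#) * X
      ≈⟨ solve 9 (λ t z U V S₂ h τ K X → let e = τ :* h in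
           t :* ((z :* t :* (𝟏 :- U) :+ U :* V :* S₂) :+ (U :- 𝟏) :* e) :+ K :+ (𝟏 :- 𝟏) :* X
           := t :* ((z :* t :* (𝟏 :- U) :+ U :* V :* S₂) :+ τ :* ((U :- 𝟏) :* h)) :+ K)
           refl t z U V S₂ (level N U V) (t ^ suc N) (K * (rhs - rhs)) X ⟩
    t * ((z * t * (1# - U) + U * V * S₂) + t ^ suc N * ((U - 1#) * level N U V)) + K * (rhs - rhs)
      ≈⟨ +-congˡ (trans (*-congˡ (-‿inverseʳ rhs)) (zeroʳ K)) ⟩
    t * ((z * t * (1# - U) + U * V * S₂) + t ^ suc N * ((U - 1#) * level N U V)) + 0#
      ≈⟨ +-identityʳ _ ⟩
    t * ((z * t * (1# - U) + U * V * S₂) + t ^ suc N * ((U - 1#) * level N U V)) ∎)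
    where
    S = truncated N U V
    S₁ = truncated N U 1#
    S₂ = truncated N (U * V) 1#
    e = t ^ suc N * level N U V
    K = 1# + t * (U - 1#)
    lhs = (1# - V) * (S + e)
    rhs = (1# - V) * (t * z) + t * ((z * (1# - V) + V) * S₁ + ((U - 1#) * V) * S + (- (U * V * V)) * S₂)
    X = t * ((1# - z) * S₁ + (U - 1#) * S - U * V * S₂) + S + e - t * z

  -- Only the recurrences of the sequences are assumed, so the concrete series stay folded. Every
  -- inverse is derived from q k = 1/(δₖγ₁⋯γₖ₊₁), the reciprocal of the denominator of summand k.
  module Iteration (u : Carrier) (uᵏ rᵏ δ γ Π q : ℕ → Carrier)
    (u-zero : uᵏ 0 ≈ 1#) (u-suc : ∀ k → uᵏ (suc k) ≈ u * uᵏ k)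
    (r-zero : rᵏ 0 ≈ 1#) (r-suc : ∀ k → rᵏ (suc k) ≈ (1# - t) * rᵏ k)
    (δ-def : ∀ k → δ k ≈ u - rᵏ k * (u - 1#))
    (γ-def : ∀ k → γ (suc k) ≈ u - (1# - z * t) * rᵏ k * (u - 1#))
    (Π-zero : Π 0 ≈ 1#) (Π-suc : ∀ k → Π (suc k) ≈ Π k * γ (suc k))
    (q-inverse : ∀ k → q k * (δ k * Π (suc k)) ≈ 1#) where

    -- This is 1/δₖ: multiplying by the γ's removes them from the denominator.
    d : ℕ → Carrier
    d k = q k * Π (suc k)

    dδ≈1 : ∀ k → d k * δ k ≈ 1#
    dδ≈1 k = trans (solve 3 (λ a b c → a :* b :* c := a :* (c :* b)) refl (q k) (Π (suc k)) (δ k)) (q-inverse k)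

    -- Divided by δₖ, this says 1 + t(u/δₖ - 1) = δₖ₊₁/δₖ, which identifies the kernel root at u/δₖ.
    δ-suc : ∀ k → δ (suc k) ≈ (1# - t) * δ k + t * u
    δ-suc k = begin
      δ (suc k)
        ≈⟨ δ-def (suc k) ⟩
      u - rᵏ (suc k) * (u - 1#)
        ≈⟨ +-congˡ (-‿cong (*-congʳ (r-suc k))) ⟩
      u - (1# - t) * rᵏ k * (u - 1#)
        ≈⟨ solve 3 (λ u t r → u :- (𝟏 :- t) :* r :* (u :- 𝟏)
             := (𝟏 :- t) :* (u :- r :* (u :- 𝟏)) :+ t :* u) refl u t (rᵏ k) ⟩
      (1# - t) * (u - rᵏ k * (u - 1#)) + t * u
        ≈⟨ +-congʳ (*-congˡ (δ-def k)) ⟨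
      (1# - t) * δ k + t * u ∎

    -- Thus γₖ₊₁ is δₖ times 1 + zt(u/δₖ - 1), the left coefficient of `kernel-equation` at U =
    -- u/δₖ.
    γ-δ : ∀ k → γ (suc k) ≈ δ k + z * t * (u - δ k)
    γ-δ k = begin
      γ (suc k)
        ≈⟨ γ-def k ⟩
      u - (1# - z * t) * rᵏ k * (u - 1#)
        ≈⟨ solve 4 (λ u z t r → u :- (𝟏 :- z :* t) :* r :* (u :- 𝟏)
             := (u :- r :* (u :- 𝟏)) :+ z :* t :* (u :- (u :- r :* (u :- 𝟏)))) refl u z t (rᵏ k) ⟩
      (u - rᵏ k * (u - 1#)) + z * t * (u - (u - rᵏ k * (u - 1#)))
        ≈⟨ +-cong (δ-def k) (*-congˡ (+-congˡ (-‿cong (δ-def k)))) ⟨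
      δ k + z * t * (u - δ k) ∎

    -- Uᵏ k = u/δₖ is the k-th iterate of u ↦ u/δ₁(u), and Vᵏ k = 1/δ₁(Uᵏ k).
    Uᵏ : ℕ → Carrier
    Uᵏ k = u * d k

    Vᵏ : ℕ → Carrier
    Vᵏ k = δ k * d (suc k)

    kernel-vanishes : ∀ k → Vᵏ k * (1# + t * (Uᵏ k - 1#)) ≈ 1#
    kernel-vanishes k = begin
      δ k * d (suc k) * (1# + t * (u * d k - 1#))
        ≈⟨ solve 5 (λ δ d′ t u d → δ :* d′ :* (𝟏 :+ t :* (u :* d :- 𝟏))
             := d′ :* ((𝟏 :- t) :* δ :+ t :* u :* (d :* δ))) refl (δ k) (d (suc k)) t u (d k) ⟩
      d (suc k) * ((1# - t) * δ k + t * u * (d k * δ k))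
        ≈⟨ *-congˡ (+-congˡ (trans (*-congˡ (dδ≈1 k)) (*-identityʳ _))) ⟩
      d (suc k) * ((1# - t) * δ k + t * u)
        ≈⟨ *-congˡ (δ-suc k) ⟨
      d (suc k) * δ (suc k)
        ≈⟨ dδ≈1 (suc k) ⟩
      1# ∎

    UV≈U : ∀ k → Uᵏ k * Vᵏ k ≈ Uᵏ (suc k)
    UV≈U k = begin
      u * d k * (δ k * d (suc k))
        ≈⟨ solve 4 (λ u d δ d′ → u :* d :* (δ :* d′) := u :* d′ :* (d :* δ)) refl u (d k) (δ k) (d (suc k)) ⟩
      u * d (suc k) * (d k * δ k)
        ≈⟨ trans (*-congˡ (dδ≈1 k)) (*-identityʳ _) ⟩
      u * d (suc k) ∎

    -- The kernel equation at u/δₖ, multiplied by δₖ. This turns the left coefficient into γₖ₊₁ and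
    -- the inhomogeneous term into zt(δₖ - u) = zt(1 - u)(1 - t)^k, the numerator of summand k apart
    -- from u^k.
    functional-equation : ∀ N k → ∃[ E ] γ (suc k) * truncated N (Uᵏ k) 1#
      ≈ (z * t * (1# - u) * rᵏ k + u * Vᵏ k * truncated N (Uᵏ (suc k)) 1#) + t ^ suc N * E
    functional-equation N k = δ k * E , (begin
      γ (suc k) * S
        ≈⟨ *-congʳ (trans (γ-δ k) (sym δK)) ⟩
      (δ k * (1# + z * t * (Uᵏ k - 1#))) * S
        ≈⟨ trans (*-assoc _ _ _) (*-congˡ (kernel-equation N (Uᵏ k) (Vᵏ k) (kernel-vanishes k))) ⟩
      δ k * ((z * t * (1# - Uᵏ k) + Uᵏ k * Vᵏ k * truncated N (Uᵏ k * Vᵏ k) 1#) + t ^ suc N * E)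
        ≈⟨ *-congˡ (+-congʳ (+-congˡ (*-congˡ (truncated-cong N 1# (UV≈U k))))) ⟩
      δ k * ((z * t * (1# - Uᵏ k) + Uᵏ k * Vᵏ k * S′) + t ^ suc N * E)
        ≈⟨ solve 9 (λ δ z t u d V S τ E →
             δ :* ((z :* t :* (𝟏 :- u :* d) :+ u :* d :* V :* S) :+ τ :* E)
             := (z :* t :* (δ :- u :* (d :* δ)) :+ u :* (d :* δ) :* V :* S) :+ τ :* (δ :* E))
             refl (δ k) z t u (d k) (Vᵏ k) S′ (t ^ suc N) E ⟩
      (z * t * (δ k - u * (d k * δ k)) + u * (d k * δ k) * Vᵏ k * S′) + t ^ suc N * (δ k * E)
        ≈⟨ +-congʳ (+-cong (*-congˡ (+-cong (δ-def k) (-‿cong udδ))) (*-congʳ (*-congʳ udδ))) ⟩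
      (z * t * ((u - rᵏ k * (u - 1#)) - u) + u * Vᵏ k * S′) + t ^ suc N * (δ k * E)
        ≈⟨ +-congʳ (+-congʳ (solve 4 (λ z t u r →
             z :* t :* ((u :- r :* (u :- 𝟏)) :- u) := z :* t :* (𝟏 :- u) :* r) refl z t u (rᵏ k))) ⟩
      (z * t * (1# - u) * rᵏ k + u * Vᵏ k * S′) + t ^ suc N * (δ k * E) ∎)
      where
      S = truncated N (Uᵏ k) 1#
      S′ = truncated N (Uᵏ (suc k)) 1#
      E = (Uᵏ k - 1#) * level N (Uᵏ k) (Vᵏ k)
      udδ : u * (d k * δ k) ≈ u
      udδ = trans (*-congˡ (dδ≈1 k)) (*-identityʳ u)
      δK : δ k * (1# + z * t * (Uᵏ k - 1#)) ≈ δ k + z * t * (u - δ k)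
      δK = begin
        δ k * (1# + z * t * (u * d k - 1#))
          ≈⟨ solve 5 (λ δ z t u d → δ :* (𝟏 :+ z :* t :* (u :* d :- 𝟏))
               := δ :+ z :* t :* (u :* (d :* δ) :- δ)) refl (δ k) z t u (d k) ⟩
        δ k + z * t * (u * (d k * δ k) - δ k)
          ≈⟨ +-congˡ (*-congˡ (+-congʳ udδ)) ⟩
        δ k + z * t * (u - δ k) ∎

    term : ℕ → Carrier
    term s = z * t * (1# - u) * uᵏ s * rᵏ s * q s

    -- The factor of u^m H(u/δₘ,1) after m iterations: 1/(δₘ γ₁ ⋯ γₘ).
    prefactor : ℕ → Carrier
    prefactor m = q m * γ (suc m)

    -- In 1/(δₘγ₁⋯γₘ₊₁) · δₘ/δₘ₊₁ the factor δₘ cancels.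
    prefactor-suc : ∀ m → q m * Vᵏ m ≈ prefactor (suc m)
    prefactor-suc m = begin
      q m * (δ m * (q (suc m) * Π (2 ℕ.+ m)))
        ≈⟨ *-congˡ (*-congˡ (*-congˡ (Π-suc (suc m)))) ⟩
      q m * (δ m * (q (suc m) * (Π (suc m) * γ (2 ℕ.+ m))))
        ≈⟨ solve 5 (λ q δ q′ Π γ → q :* (δ :* (q′ :* (Π :* γ))) := q′ :* γ :* (q :* (δ :* Π)))
             refl (q m) (δ m) (q (suc m)) (Π (suc m)) (γ (2 ℕ.+ m)) ⟩
      prefactor (suc m) * (q m * (δ m * Π (suc m)))
        ≈⟨ trans (*-congˡ (q-inverse m)) (*-identityʳ _) ⟩
      prefactor (suc m) ∎

    δ-zero : δ 0 ≈ 1#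
    δ-zero = trans (δ-def 0) (trans (+-congˡ (-‿cong (*-congʳ r-zero)))
      (solve 1 (λ u → u :- 𝟏 :* (u :- 𝟏) := 𝟏) refl u))

    prefactor-zero : prefactor 0 ≈ 1#
    prefactor-zero = begin
      q 0 * γ 1               ≈⟨ *-congˡ (trans (sym (*-identityˡ _)) (sym (*-identityˡ _))) ⟩
      q 0 * (1# * (1# * γ 1)) ≈⟨ *-congˡ (*-cong δ-zero (trans (Π-suc 0) (*-congʳ Π-zero))) ⟨
      q 0 * (δ 0 * Π 1)       ≈⟨ q-inverse 0 ⟩
      1#                      ∎

    U-zero : Uᵏ 0 ≈ u
    U-zero = trans (*-congˡ (trans (sym (*-identityʳ _)) (trans (*-congˡ (sym δ-zero)) (dδ≈1 0)))) (*-identityʳ u)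

    -- Since `prefactor m` contains the factor γₘ₊₁, the functional equation applies to the
    -- remainder: its inhomogeneous part becomes `term m`, and its factor u raises the power of u in
    -- the new remainder.
    expansion : ∀ N m → ∃[ E ] truncated N u 1#
      ≈ (∑ m term + uᵏ m * (prefactor m * truncated N (Uᵏ m) 1#)) + t ^ suc N * E
    expansion N zero = 0# , sym (begin
      (0# + uᵏ 0 * (prefactor 0 * truncated N (Uᵏ 0) 1#)) + t ^ suc N * 0#
        ≈⟨ +-congʳ (+-congˡ (*-cong u-zero (*-cong prefactor-zero (truncated-cong N 1# U-zero)))) ⟩
      (0# + 1# * (1# * truncated N u 1#)) + t ^ suc N * 0#
        ≈⟨ solve 2 (λ S τ → (𝟎 :+ 𝟏 :* (𝟏 :* S)) :+ τ :* 𝟎 := S) refl (truncated N u 1#) (t ^ suc N) ⟩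
      truncated N u 1# ∎)
    expansion N (suc m) = E + uᵏ m * q m * E′ , (begin
      truncated N u 1#
        ≈⟨ ih ⟩
      (∑ m term + uᵏ m * (q m * γ (suc m) * S)) + τ * E
        ≈⟨ +-congʳ (+-congˡ (*-congˡ (trans (*-assoc _ _ _) (*-congˡ fe)))) ⟩
      (∑ m term + uᵏ m * (q m * ((z * t * (1# - u) * rᵏ m + u * Vᵏ m * S′) + τ * E′))) + τ * E
        ≈⟨ solve 12 (λ A p q z t u r V S τ E E′ →
             (A :+ p :* (q :* ((z :* t :* (𝟏 :- u) :* r :+ u :* V :* S) :+ τ :* E′))) :+ τ :* E
             := ((A :+ z :* t :* (𝟏 :- u) :* p :* r :* q) :+ (u :* p) :* ((q :* V) :* S)) :+ τ :* (E :+ p :* q :* E′))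
             refl (∑ m term) (uᵏ m) (q m) z t u (rᵏ m) (Vᵏ m) S′ τ E E′ ⟩
      ((∑ m term + term m) + (u * uᵏ m) * ((q m * Vᵏ m) * S′)) + τ * (E + uᵏ m * q m * E′)
        ≈⟨ +-congʳ (+-congˡ (*-cong (sym (u-suc m)) (*-congʳ (prefactor-suc m)))) ⟩
      (∑ (suc m) term + uᵏ (suc m) * (prefactor (suc m) * S′)) + τ * (E + uᵏ m * q m * E′) ∎)
      where
      S = truncated N (Uᵏ m) 1#
      S′ = truncated N (Uᵏ (suc m)) 1#
      τ = t ^ suc N
      E = proj₁ (expansion N m)
      ih = proj₂ (expansion N m)
      E′ = proj₁ (functional-equation N m)
      fe = proj₂ (functional-equation N m)

    -- Stated with operations that merely agree with those of R, so that for
    -- series the result mentions _⊛_ itself and no product has to be unfolded.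
    module Rewritten (_·_ _⊝_ : Carrier → Carrier → Carrier) (e : Carrier)
      (·-def : ∀ x y → x · y ≈ x * y) (⊝-def : ∀ x y → x ⊝ y ≈ x - y) (e-def : e ≈ 1#) where

      term-in : ∀ s → (((((z · t) · (e ⊝ u)) · uᵏ s) · rᵏ s) · q s) ≈ term s
      term-in s = ·-to (·-to (·-to (·-to (·-def z t)
        (trans (⊝-def e u) (+-congʳ e-def))) refl) refl) refl
        where
        ·-to : ∀ {x x′ y y′} → x ≈ x′ → y ≈ y′ → x · y ≈ x′ * y′
        ·-to p r = trans (·-def _ _) (*-cong p r)

      abstract
        expansion-in : ∀ N m → ∃[ G ] ∃[ E ] truncated N u 1# ≈ (∑ m term + (uᵏ m · G)) + ((t ^ suc N) · E)
        expansion-in N m = G , proj₁ (expansion N m) , trans (proj₂ (expansion N m))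
          (sym (+-cong (+-congˡ (·-def (uᵏ m) G)) (·-def (t ^ suc N) (proj₁ (expansion N m)))))
          where
          G : Carrier
          G = prefactor m * truncated N (Uᵏ m) 1#

-- Coefficients

sumTo-zero : ∀ n {f : ℕ → ℤ} → (∀ i → i < n → f i ≡ + 0) → sumTo n f ≡ + 0
sumTo-zero zero    e = ≡.refl
sumTo-zero (suc n) e = ≡.cong₂ ℤ._+_ (sumTo-zero n λ i i<n → e i (ℕP.m<n⇒m<1+n i<n)) (e n ℕP.≤-refl)

module S = CommutativeRing seriesRing
open Exp S.commutativeSemiring using (_^_)

module _ {c ℓ} (R : CommutativeRing c ℓ) where
  open CommutativeRing R
  open PowerSeries R

  -- `Z` and `T` live in the coefficient ring of the outer levels. There they are constants, and the
  -- convolution collapses to a scaling.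
  constant-✶ : ∀ x f → (∀ n → x (suc n) ≈ 0#) → ∀ n → (x ✶ f) n ≈ x 0 * f n
  constant-✶ x f e zero    = refl
  constant-✶ x f e (suc n) =
    trans (+-congˡ (trans (✶-cong e (λ _ → refl) n) (✶-zeroˡ f n))) (+-identityʳ _)

  indeterminate-✶ : ∀ x f → x 0 ≈ 0# → (∀ n → x (suc n) ≈ 𝟙 n) → ∀ n → (x ✶ f) (suc n) ≈ f n
  indeterminate-✶ x f e₀ e n =
    trans (+-cong (trans (*-congʳ e₀) (zeroˡ _)) (trans (✶-cong e (λ _ → refl) n) (✶-identityˡ f n))) (+-identityˡ _)

  -- Used to bring the power of `U` in a summand to the front, where `pow-U-low` applies.
  move-to-front : ∀ x p r q → x * p * r * q ≈ p * (x * r * q)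
  move-to-front = solve 4 (λ x p r q → x :* p :* r :* q := p :* (x :* r :* q)) refl
    where open ℤSolver R

U-⊛-zero : ∀ f b c → (U ⊛ f) 0 b c ≡ + 0
U-⊛-zero f b c = ≡.trans (⊛-✶ U f 0 b c) (CommutativeRing.zeroˡ ℤ[Z,T] (f 0) b c)

U-⊛-suc : ∀ f a b c → (U ⊛ f) (suc a) b c ≡ f a b c
U-⊛-suc f a b c = ≡.trans (⊛-✶ U f (suc a) b c) (indeterminate-✶ ℤ[Z,T] U f (λ _ _ → ≡.refl) U₁ a b c)
  where
  U₁ : ∀ n b c → U (suc n) b c ≡ PowerSeries.𝟙 ℤ[Z,T] n b c
  U₁ zero    zero    zero    = ≡.refl
  U₁ zero    zero    (suc c) = ≡.refl
  U₁ zero    (suc b) c       = ≡.refl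
  U₁ (suc n) b       c       = ≡.refl

Z-⊛ : ∀ f a b c → (Z ⊛ f) a b c ≡ PowerSeries._✶_ ℤ[T] (Z 0) (f a) b c
Z-⊛ f a b c = ≡.trans (⊛-✶ Z f a b c) (constant-✶ ℤ[Z,T] Z f (λ _ _ _ → ≡.refl) a b c)

Z-⊛-zero : ∀ f a c → (Z ⊛ f) a 0 c ≡ + 0
Z-⊛-zero f a c = ≡.trans (Z-⊛ f a 0 c) (CommutativeRing.zeroˡ ℤ[T] (f a 0) c)

Z-⊛-suc : ∀ f a b c → (Z ⊛ f) a (suc b) c ≡ f a b c
Z-⊛-suc f a b c = ≡.trans (Z-⊛ f a (suc b) c) (indeterminate-✶ ℤ[T] (Z 0) (f a) (λ _ → ≡.refl) Z₁ b c)
  where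
  Z₁ : ∀ n c → Z 0 (suc n) c ≡ PowerSeries.𝟙 ℤ[T] n c
  Z₁ zero    zero    = ≡.refl
  Z₁ zero    (suc c) = ≡.refl
  Z₁ (suc n) c       = ≡.refl

T-⊛ : ∀ f a b c → (T ⊛ f) a b c ≡ PowerSeries._✶_ ℤ-ring (T 0 0) (f a b) c
T-⊛ f a b c = ≡.trans (⊛-✶ T f a b c) (≡.trans (constant-✶ ℤ[Z,T] T f (λ _ _ _ → ≡.refl) a b c)
  (constant-✶ ℤ[T] (T 0) (f a) (λ _ _ → ≡.refl) b c))

T-⊛-zero : ∀ f a b → (T ⊛ f) a b 0 ≡ + 0
T-⊛-zero f a b = ≡.trans (T-⊛ f a b 0) (ℤP.*-zeroˡ (f a b 0))

T-⊛-suc : ∀ f a b c → (T ⊛ f) a b (suc c) ≡ f a b c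
T-⊛-suc f a b c = ≡.trans (T-⊛ f a b (suc c)) (indeterminate-✶ ℤ-ring (T 0 0) (f a b) ≡.refl T₁ c)
  where
  T₁ : ∀ n → T 0 0 (suc n) ≡ PowerSeries.𝟙 ℤ-ring n
  T₁ zero    = ≡.refl
  T₁ (suc n) = ≡.refl

-- Multiplication by `T` only shifts coefficients, so none is lost.
T-cancel : Cancellable seriesRing T
at (T-cancel f g e) a b c = ≡.trans (≡.sym (T-⊛-suc f a b c)) (≡.trans (at e a b (suc c)) (T-⊛-suc g a b c))

pow-U-low : ∀ s f a b c → a < s → (pow U s ⊛ f) a b c ≡ + 0
pow-U-low (suc s) f zero    b c _         = ≡.trans (at (S.*-assoc U (pow U s) f) 0 b c) (U-⊛-zero (pow U s ⊛ f) b c)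
pow-U-low (suc s) f (suc a) b c (s≤s a<s) = ≡.trans (at (S.*-assoc U (pow U s) f) (suc a) b c)
  (≡.trans (U-⊛-suc (pow U s ⊛ f) a b c) (pow-U-low s f a b c a<s))

T^-low : ∀ k f a b c → c < k → (T ^ k ⊛ f) a b c ≡ + 0
T^-low (suc k) f a b zero    _         = ≡.trans (at (S.*-assoc T (T ^ k) f) a b 0) (T-⊛-zero (T ^ k ⊛ f) a b)
T^-low (suc k) f a b (suc c) (s≤s c<k) = ≡.trans (at (S.*-assoc T (T ^ k) f) a b (suc c))
  (≡.trans (T-⊛-suc (T ^ k ⊛ f) a b c) (T^-low k f a b c c<k))

T^-shift : ∀ k f a b c {n} → k ℕ.+ c ≡ n → (T ^ k ⊛ f) a b n ≡ f a b c
T^-shift zero    f a b c         ≡.refl = at (S.*-identityˡ f) a b c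
T^-shift (suc k) f a b c {suc n} e = ≡.trans (at (S.*-assoc T (T ^ k) f) a b (suc n))
  (≡.trans (T-⊛-suc (T ^ k ⊛ f) a b n) (T^-shift k f a b c (ℕP.suc-injective e)))

-- Recursive, so that lowering both arguments computes, in step with the coefficient shift caused by
-- one factor `U` or `Z`.
kronecker : ℕ → ℕ → ℤ
kronecker zero    zero    = + 1
kronecker zero    (suc _) = + 0
kronecker (suc _) zero    = + 0
kronecker (suc i) (suc j) = kronecker i j

one-coefficient : ∀ a b c → one a b c ≡ kronecker 0 a ℤ.* (kronecker 0 b ℤ.* kronecker 0 c)
one-coefficient zero    zero    zero    = ≡.refl
one-coefficient zero    zero    (suc c) = ≡.refl
one-coefficient zero    (suc b) c       = ≡.refl
one-coefficient (suc a) b       c       = ≡.refl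

Z^-coefficient : ∀ j a b c → (Z ^ j) a b c ≡ kronecker 0 a ℤ.* (kronecker j b ℤ.* kronecker 0 c)
Z^-coefficient zero    a b c       = one-coefficient a b c
Z^-coefficient (suc j) a zero c    = ≡.trans (Z-⊛-zero (Z ^ j) a c) (≡.sym (ℤP.*-zeroʳ (kronecker 0 a)))
Z^-coefficient (suc j) a (suc b) c = ≡.trans (Z-⊛-suc (Z ^ j) a b c) (Z^-coefficient j a b c)

U^Z^-coefficient : ∀ i j a b c →
  (U ^ i ⊛ Z ^ j) a b c ≡ kronecker i a ℤ.* (kronecker j b ℤ.* kronecker 0 c)
U^Z^-coefficient zero    j a       b c = ≡.trans (at (S.*-identityˡ (Z ^ j)) a b c) (Z^-coefficient j a b c)
U^Z^-coefficient (suc i) j zero    b c = ≡.trans (at (S.*-assoc U (U ^ i) (Z ^ j)) 0 b c) (U-⊛-zero (U ^ i ⊛ Z ^ j) b c)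
U^Z^-coefficient (suc i) j (suc a) b c = ≡.trans (at (S.*-assoc U (U ^ i) (Z ^ j)) (suc a) b c)
  (≡.trans (U-⊛-suc (U ^ i ⊛ Z ^ j) a b c) (U^Z^-coefficient i j a b c))

⊛-constant : ∀ f g → (f ⊛ g) 0 0 0 ≡ f 0 0 0 ℤ.* g 0 0 0
⊛-constant f g = ⊛-✶ f g 0 0 0

pow-constant : ∀ f k → f 0 0 0 ≡ + 1 → pow f k 0 0 0 ≡ + 1
pow-constant f zero    e = ≡.refl
pow-constant f (suc k) e = ≡.trans (⊛-constant f (pow f k)) (≡.cong₂ ℤ._*_ e (pow-constant f k e))

δ-constant : ∀ k → δ k 0 0 0 ≡ + 1
δ-constant zero    = ≡.refl
δ-constant (suc k) = ≡.cong (ℤ._-_ (+ 0)) (≡.trans (⊛-constant (pow (one ⊖ T) (suc k)) (U ⊖ one))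
  (≡.cong (ℤ._* (ℤ.- + 1)) (pow-constant (one ⊖ T) (suc k) ≡.refl)))

γ-constant : ∀ k → γ k 0 0 0 ≡ + 1
γ-constant zero    = ≡.refl
γ-constant (suc k) = ≡.cong (ℤ._-_ (+ 0)) (≡.trans (⊛-constant ((one ⊖ Z ⊛ T) ⊛ pow (one ⊖ T) k) (U ⊖ one))
  (≡.cong (ℤ._* (ℤ.- + 1)) (≡.trans (⊛-constant (one ⊖ Z ⊛ T) (pow (one ⊖ T) k))
    (≡.cong₂ ℤ._*_ (≡.refl {x = + 1}) (pow-constant (one ⊖ T) k ≡.refl)))))

prodγ-constant : ∀ k → prodγ k 0 0 0 ≡ + 1
prodγ-constant zero    = ≡.refl
prodγ-constant (suc k) = ≡.trans (⊛-constant (prodγ k) (γ (suc k)))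
  (≡.cong₂ ℤ._*_ (prodγ-constant k) (γ-constant (suc k)))

-- Inverses of series with constant term 1

module Inverse (f : Series) (f-constant : f 0 0 0 ≡ + 1) where
  open ℤSolver seriesRing

  VanishesBelow : ℕ → Series → Set
  VanishesBelow m g = ∀ a b c → a ℕ.+ b ℕ.+ c < m → g a b c ≡ + 0

  ⊛-raises-order : ∀ {m g} → VanishesBelow m g → VanishesBelow (suc m) ((f ⊖ one) ⊛ g)
  ⊛-raises-order {m} {g} v a b c (s≤s a+b+c≤m) =
    sumTo-zero (suc a) λ i i≤a → sumTo-zero (suc b) λ j j≤b → sumTo-zero (suc c) λ k k≤c →
      product i j k (ℕP.≤-pred i≤a) (ℕP.≤-pred j≤b) (ℕP.≤-pred k≤c)
    where
    vanish : ∀ i j k → (a ∸ i) ℕ.+ (b ∸ j) ℕ.+ (c ∸ k) < a ℕ.+ b ℕ.+ c →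
      (f ⊖ one) i j k ℤ.* g (a ∸ i) (b ∸ j) (c ∸ k) ≡ + 0
    vanish i j k lt = ≡.trans (≡.cong ((f ⊖ one) i j k ℤ.*_) (v _ _ _ (ℕP.<-≤-trans lt a+b+c≤m)))
      (ℤP.*-zeroʳ ((f ⊖ one) i j k))
    shrink : ∀ {n i} → suc i ≤ n → n ∸ suc i < n
    shrink {suc n} {i} _ = s≤s (ℕP.m∸n≤m n i)
    product : ∀ i j k → i ≤ a → j ≤ b → k ≤ c → (f ⊖ one) i j k ℤ.* g (a ∸ i) (b ∸ j) (c ∸ k) ≡ + 0
    -- The only index triple at which g is not evaluated in lower total degree; here the constant
    -- term of f - 1 vanishes instead.
    product zero zero zero _ _ _ = ≡.trans (≡.cong (λ x → (x ℤ.- + 1) ℤ.* g a b c) f-constant) (ℤP.*-zeroˡ (g a b c))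
    product (suc i) j k p q r = vanish (suc i) j k
      (ℕP.+-mono-<-≤ (ℕP.+-mono-<-≤ (shrink p) (ℕP.m∸n≤m b j)) (ℕP.m∸n≤m c k))
    product zero (suc j) k p q r = vanish zero (suc j) k
      (ℕP.+-mono-<-≤ (ℕP.+-mono-≤-< (ℕP.≤-refl {a}) (shrink q)) (ℕP.m∸n≤m c k))
    product zero zero (suc k) p q r = vanish zero zero (suc k)
      (ℕP.+-mono-≤-< (ℕP.≤-refl {a ℕ.+ b}) (shrink r))

  -- The difference of successive iterates is -(f - 1) times the preceding difference, so each
  -- iteration gains one order.
  consecutive : ∀ m → VanishesBelow m (invIter m f ⊖ invIter (suc m) f)
  consecutive (suc m) a b c lt = ≡.trans (at eq a b c)
    (≡.cong ℤ.-_ (⊛-raises-order (consecutive m) a b c lt))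
    where
    eq : (one ⊖ (f ⊖ one) ⊛ invIter m f) ⊖ (one ⊖ (f ⊖ one) ⊛ invIter (suc m) f)
         ≋ S.- ((f ⊖ one) ⊛ (invIter m f ⊖ invIter (suc m) f))
    eq = solve 3 (λ e g h → (con (+ 1) :- e :* g) :- (con (+ 1) :- e :* h) := :- (e :* (g :- h)))
           S.refl (f ⊖ one) (invIter m f) (invIter (suc m) f)

  stable : ∀ m e a b c → a ℕ.+ b ℕ.+ c < m → invIter (e ℕ.+ m) f a b c ≡ invIter m f a b c
  stable m zero    a b c lt = ≡.refl
  stable m (suc e) a b c lt = ≡.trans
    (≡.sym (ℤP.i-j≡0⇒i≡j _ _ (consecutive (e ℕ.+ m) a b c (ℕP.<-≤-trans lt (ℕP.m≤n+m m e)))))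
    (stable m e a b c lt)

  inv-stable : ∀ m a b c → a ℕ.+ b ℕ.+ c < m → inv f a b c ≡ invIter m f a b c
  inv-stable m a b c lt = ≡.trans (≡.sym (stable _ (m ∸ suc (a ℕ.+ b ℕ.+ c)) a b c ℕP.≤-refl))
    (≡.cong (λ n → invIter n f a b c) (ℕP.m∸n+n≡m lt))

  -- The coefficient at (a, b, c) sees `inv f` only up to total degree a + b + c, where it agrees
  -- with the iterate gₘ for m = a + b + c + 1. For that iterate f gₘ = 1 + (gₘ - gₘ₊₁), and the
  -- difference vanishes in this degree.
  inverse : (f ⊛ inv f) ≋ one
  at inverse a b c = ≡.trans truncate (≡.trans (at eq a b c)
    (≡.trans (≡.cong (λ x → one a b c ℤ.+ x) (consecutive m a b c ℕP.≤-refl)) (ℤP.+-identityʳ _)))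
    where
    m = suc (a ℕ.+ b ℕ.+ c)
    truncate : (f ⊛ inv f) a b c ≡ (f ⊛ invIter m f) a b c
    truncate = sumTo-cong (suc a) λ i _ → sumTo-cong (suc b) λ j _ → sumTo-cong (suc c) λ k _ →
      ≡.cong (f i j k ℤ.*_) (inv-stable m (a ∸ i) (b ∸ j) (c ∸ k)
        (s≤s (ℕP.+-mono-≤ (ℕP.+-mono-≤ (ℕP.m∸n≤m a i) (ℕP.m∸n≤m b j)) (ℕP.m∸n≤m c k))))
    eq : (f ⊛ invIter m f) ≋ (one ⊕ (invIter m f ⊖ (one ⊖ (f ⊖ one) ⊛ invIter m f)))
    eq = solve 2 (λ f g → f :* g := con (+ 1) :+ (g :- (con (+ 1) :- (f :- con (+ 1)) :* g)))
           S.refl f (invIter m f)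

-- The expansion for the actual series

module Kernel = KernelMethod seriesRing Z T T-cancel

δ-def : ∀ k → δ k ≋ (U ⊖ pow (one ⊖ T) k ⊛ (U ⊖ one))
δ-def zero    = solve 1 (λ u → con (+ 1) := u :- con (+ 1) :* (u :- con (+ 1))) S.refl U
  where open ℤSolver seriesRing
δ-def (suc k) = S.refl

q : ℕ → Series
q s = inv (δ s ⊛ prodγ (suc s))

q-inverse : ∀ s → (q s ⊛ (δ s ⊛ prodγ (suc s))) ≋ one
q-inverse s = S.trans (S.*-comm (q s) (δ s ⊛ prodγ (suc s))) (Inverse.inverse (δ s ⊛ prodγ (suc s))
  (≡.trans (⊛-constant (δ s) (prodγ (suc s))) (≡.cong₂ ℤ._*_ (δ-constant s) (prodγ-constant (suc s)))))

γ-def : ∀ k → γ (suc k) ≋ U ⊖ (one ⊖ Z ⊛ T) ⊛ pow (one ⊖ T) k ⊛ (U ⊖ one)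
γ-def k = S.refl

prodγ-def : ∀ k → prodγ (suc k) ≋ prodγ k ⊛ γ (suc k)
prodγ-def k = S.refl

pow-def : ∀ f k → pow f (suc k) ≋ f ⊛ pow f k
pow-def f k = S.refl

⊛-def : ∀ f g → f ⊛ g ≋ f S.* g
⊛-def f g = S.refl

⊖-def : ∀ f g → f ⊖ g ≋ f S.- g
⊖-def f g = wrap λ _ _ _ → ≡.refl

module Iterates = Kernel.Iteration U (pow U) (pow (one ⊖ T)) δ γ prodγ q
  S.refl (pow-def U) S.refl (pow-def (one ⊖ T)) δ-def γ-def S.refl prodγ-def q-inverse

summand-low : ∀ s a b n → a < s → summand s a b n ≡ + 0
summand-low s a b n a<s = ≡.trans
  (at (move-to-front seriesRing (Z ⊛ T ⊛ (one ⊖ U)) (pow U s) (pow (one ⊖ T) s) (q s)) a b n)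
  (pow-U-low s (Z ⊛ T ⊛ (one ⊖ U) ⊛ pow (one ⊖ T) s ⊛ q s) a b n a<s)

module ℤTree = Tree ℤ-ring
open Sums seriesRing using () renaming (∑ to ∑ˢ)

∑-coefficient : ∀ n F a b c → ∑ˢ n F a b c ≡ sumTo n (λ i → F i a b c)
∑-coefficient zero    F a b c = ≡.refl
∑-coefficient (suc n) F a b c = ≡.cong (ℤ._+ F n a b c) (∑-coefficient n F a b c)

walks-coefficient : ∀ k F s a b c →
  Tree.walks seriesRing F k s a b c ≡ ℤTree.walks (λ s → F s a b c) k s
walks-coefficient zero    F s a b c = ≡.refl
walks-coefficient (suc k) F s a b c = ≡.trans (∑-coefficient (2 ℕ.+ proj₁ s) (λ x → Tree.walks seriesRing F k (next s x)) a b c)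
  (≡.trans (sumTo-cong (2 ℕ.+ proj₁ s) λ x _ → walks-coefficient k F (next s x) a b c)
    (≡.sym (sumTo-∑ (2 ℕ.+ proj₁ s) (λ x → ℤTree.walks (λ s → F s a b c) k (next s x)))))

indicator : ℕ → ℕ → State → ℤ
indicator a b (i , _ , j) = kronecker i a ℤ.* kronecker j b

weight-coefficient : ∀ i l j a b c → Kernel.weight U one (i , l , j) a b c
  ≡ kronecker i a ℤ.* (kronecker j b ℤ.* kronecker 0 c)
weight-coefficient i l j a b c = ≡.trans
  (at (S.*-congʳ {Z ^ j} (S.trans (S.*-congˡ {U ^ i} (Kernel.1^n≈1 l)) (S.*-identityʳ (U ^ i)))) a b c)
  (U^Z^-coefficient i j a b c)

level-coefficient : ∀ n a b → Kernel.level n U one a b 0 ≡ ℤTree.walks (indicator a b) n (0 , 0 , 1)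
level-coefficient n a b = ≡.trans (walks-coefficient n (Kernel.weight U one) (0 , 0 , 1) a b 0)
  (ℤTree.walks-cong n (λ { (i , l , j) _ → ≡.trans (weight-coefficient i l j a b 0)
    (≡.cong (kronecker i a ℤ.*_) (ℤP.*-identityʳ (kronecker j b))) }) (0 , 0 , 1) z≤n)

level-coefficient-suc : ∀ n a b c → Kernel.level n U one a b (suc c) ≡ + 0
level-coefficient-suc n a b c = ≡.trans (walks-coefficient n (Kernel.weight U one) (0 , 0 , 1) a b (suc c))
  -- Zero is written as 0 · 0 so that `walks-*` can pull out a factor 0.
  (≡.trans (ℤTree.walks-cong n {g = λ _ → + 0 ℤ.* + 0} (λ { (i , l , j) _ → ≡.trans (weight-coefficient i l j a b (suc c))
    (≡.trans (≡.cong (kronecker i a ℤ.*_) (ℤP.*-zeroʳ (kronecker j b))) (ℤP.*-zeroʳ (kronecker i a))) }) (0 , 0 , 1) z≤n)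
  (≡.trans (ℤTree.walks-* n (+ 0) (λ _ → + 0) (0 , 0 , 1) z≤n) (ℤP.*-zeroˡ (ℤTree.walks (λ _ → + 0) n (0 , 0 , 1)))))

-- Levels do not involve `T`, so level k contributes to t^(k+1) alone and only the last summand
-- survives.
truncated-coefficient : ∀ n a b →
  Kernel.truncated (suc n) U one a b (suc n) ≡ ℤTree.walks (indicator a b) n (0 , 0 , 1)
truncated-coefficient n a b = begin
  ∑ˢ (suc n) F a b (suc n)                            ≡⟨ ∑-coefficient (suc n) F a b (suc n) ⟩
  sumTo n (λ k → F k a b (suc n)) ℤ.+ F n a b (suc n) ≡⟨ ≡.cong (ℤ._+ F n a b (suc n)) (sumTo-zero n lower) ⟩
  + 0 ℤ.+ F n a b (suc n)                             ≡⟨ ℤP.+-identityˡ (F n a b (suc n)) ⟩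
  F n a b (suc n)                                     ≡⟨ T^-shift (suc n) (Kernel.level n U one) a b 0 (ℕP.+-identityʳ (suc n)) ⟩
  Kernel.level n U one a b 0                          ≡⟨ level-coefficient n a b ⟩
  ℤTree.walks (indicator a b) n (0 , 0 , 1)           ∎
  where
  open ≡.≡-Reasoning
  F : ℕ → Series
  F k = T ^ suc k ⊛ Kernel.level k U one
  lower : ∀ k → k < n → F k a b (suc n) ≡ + 0
  lower k k<n = ≡.trans
    (T^-shift (suc k) (Kernel.level k U one) a b (suc (n ∸ suc k))
      (≡.cong suc (≡.trans (ℕP.+-suc k (n ∸ suc k)) (ℕP.m+[n∸m]≡n k<n))))
    (level-coefficient-suc k a b (n ∸ suc k))

module Iterates⊛ = Iterates.Rewritten _⊛_ _⊖_ one ⊛-def ⊖-def S.refl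

-- After a + 1 iterations the remainder is a multiple of u^(a+1), and the truncation error is a
-- multiple of t^(N+1) with N ≥ n; neither reaches u^a t^n.
partial-sum : ∀ N a b n → n ≤ N → Kernel.truncated N U one a b n ≡ sumTo (suc a) (λ s → summand s a b n)
partial-sum N a b n n≤N = begin
  Kernel.truncated N U one a b n
    ≡⟨ at (proj₂ (proj₂ (Iterates⊛.expansion-in N (suc a)))) a b n ⟩
  ∑ˢ (suc a) Iterates.term a b n ℤ.+ (pow U (suc a) ⊛ G) a b n ℤ.+ (T ^ suc N ⊛ E) a b n
    ≡⟨ ≡.cong₂ (λ x y → ∑ˢ (suc a) Iterates.term a b n ℤ.+ x ℤ.+ y)
         (pow-U-low (suc a) G a b n ℕP.≤-refl) (T^-low (suc N) E a b n (s≤s n≤N)) ⟩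
  ∑ˢ (suc a) Iterates.term a b n ℤ.+ + 0 ℤ.+ + 0
    ≡⟨ ≡.trans (ℤP.+-identityʳ _) (ℤP.+-identityʳ _) ⟩
  ∑ˢ (suc a) Iterates.term a b n
    ≡⟨ ∑-coefficient (suc a) Iterates.term a b n ⟩
  sumTo (suc a) (λ s → Iterates.term s a b n)
    ≡⟨ sumTo-cong (suc a) (λ s _ → ≡.sym (at (Iterates⊛.term-in s) a b n)) ⟩
  sumTo (suc a) (λ s → summand s a b n) ∎
  where
  open ≡.≡-Reasoning
  G E : Series
  G = proj₁ (Iterates⊛.expansion-in N (suc a))
  E = proj₁ (proj₂ (Iterates⊛.expansion-in N (suc a)))

-- Counting ascent sequences

asc-∷ʳ : ∀ q l x → asc ((q ∷ʳ l) ∷ʳ x) ≡ (if l <ᵇ x then 1 else 0) ℕ.+ asc (q ∷ʳ l)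
asc-∷ʳ [] l x = ≡.refl
asc-∷ʳ (y ∷ []) l x = x∙yz≈y∙xz ℕP.+-commutativeSemigroup (if y <ᵇ l then 1 else 0) (if l <ᵇ x then 1 else 0) 0
asc-∷ʳ (y ∷ z ∷ q) l x = ≡.trans (≡.cong ((if y <ᵇ z then 1 else 0) ℕ.+_) (asc-∷ʳ (z ∷ q) l x))
  (x∙yz≈y∙xz ℕP.+-commutativeSemigroup (if y <ᵇ z then 1 else 0) (if l <ᵇ x then 1 else 0) (asc ((z ∷ q) ∷ʳ l)))

asc-bound : ∀ w → asc w ≤ length w ∸ 1
asc-bound [] = z≤n
asc-bound (x ∷ []) = z≤n
asc-bound (x ∷ y ∷ r) = ℕP.+-mono-≤ (bit (x <ᵇ y)) (asc-bound (y ∷ r))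
  where
  bit : ∀ b → (if b then 1 else 0) ≤ 1
  bit true  = ℕP.≤-refl
  bit false = z≤n

zeros-∷ʳ : ∀ p x → zeros (p ∷ʳ x) ≡ isZero x ℕ.+ zeros p
zeros-∷ʳ p x = ≡.trans (≡.cong length (filter-++ (ℕ._≟ 0) p (x ∷ [])))
  (≡.trans (length-++ (filter (ℕ._≟ 0) p)) (≡.trans (ℕP.+-comm (zeros p) _) (≡.cong (ℕ._+ zeros p) (singleton x))))
  where
  singleton : ∀ x → zeros (x ∷ []) ≡ isZero x
  singleton zero    = ≡.refl
  singleton (suc x) = ≡.refl

length-∷ʳ : ∀ (q : List ℕ) l → length (q ∷ʳ l) ≡ suc (length q)
length-∷ʳ q l = ≡.trans (length-++ q) (ℕP.+-comm (length q) 1)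

nth-++ : ∀ p c {i} → i < length p → nth (p ++ c) i ≡ nth p i
nth-++ (x ∷ p) c {zero}  _         = ≡.refl
nth-++ (x ∷ p) c {suc i} (s≤s i<) = nth-++ p c i<

nth-length : ∀ p x c → nth (p ++ x ∷ c) (length p) ≡ x
nth-length []      x c = ≡.refl
nth-length (_ ∷ p) x c = nth-length p x c

take-++ : ∀ (p c : List ℕ) {i} → i ≤ length p → take i (p ++ c) ≡ take i p
take-++ p       c {zero}  _        = ≡.refl
take-++ (x ∷ p) c {suc i} (s≤s i≤) = ≡.cong (x ∷_) (take-++ p c i≤)

take-length : ∀ (p c : List ℕ) → take (length p) (p ++ c) ≡ p
take-length []      c = ≡.refl
take-length (x ∷ p) c = ≡.cong (x ∷_) (take-length p c)

-- Prefixes are written `q ∷ʳ l` both to expose the last letter and to give them length suc (length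
-- q), so that the position of x has the successor form required by `applyUpTo suc`.
IsAscent-bound : ∀ q l x c → IsAscent ((q ∷ʳ l) ++ x ∷ c) → x ≤ suc (asc (q ∷ʳ l))
IsAscent-bound q l x c (_ , _ , bounds) =
  ≡.subst₂ (λ y p → y ≤ suc (asc p))
    (≡.trans (≡.cong (nth ((q ∷ʳ l) ++ x ∷ c)) (≡.sym (length-∷ʳ q l))) (nth-length (q ∷ʳ l) x c))
    (≡.trans (≡.cong (λ i → take i ((q ∷ʳ l) ++ x ∷ c)) (≡.sym (length-∷ʳ q l))) (take-length (q ∷ʳ l) (x ∷ c)))
    (applyUpTo⁻ suc _ bounds inside)
  where
  inside : length q < length ((q ∷ʳ l) ++ x ∷ c) ∸ 1
  inside rewrite length-++ (q ∷ʳ l) {x ∷ c} | length-∷ʳ q l | ℕP.+-suc (length q) (length c) =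
    s≤s (ℕP.m≤m+n (length q) (length c))

IsAscent-∷ʳ : ∀ q l x → IsAscent (q ∷ʳ l) → x ≤ suc (asc (q ∷ʳ l)) → IsAscent ((q ∷ʳ l) ∷ʳ x)
IsAscent-∷ʳ q l x (1≤ , first , bounds) x≤ =
  ≡.subst (1 ≤_) (≡.sym (length-∷ʳ p x)) (s≤s z≤n) ,
  ≡.trans (nth-++ p (x ∷ []) 1≤) first ,
  applyUpTo⁺₁ suc (length (p ∷ʳ x) ∸ 1) bound
  where
  p = q ∷ʳ l
  bound : ∀ {i} → i < length (p ∷ʳ x) ∸ 1 → nth (p ∷ʳ x) (suc i) ≤ suc (asc (take (suc i) (p ∷ʳ x)))
  bound {i} i< with ℕP.m≤n⇒m<n∨m≡n (≡.subst (λ n → i < n ∸ 1) (length-∷ʳ p x) i<)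
  ... | inj₁ 1+i<p = ≡.subst₂ (λ y r → y ≤ suc (asc r))
    (≡.sym (nth-++ p (x ∷ []) 1+i<p)) (≡.sym (take-++ p (x ∷ []) (ℕP.<⇒≤ 1+i<p)))
    (applyUpTo⁻ suc (length p ∸ 1) bounds (ℕP.∸-monoˡ-≤ 1 1+i<p))
  ... | inj₂ 1+i≡p rewrite 1+i≡p = ≡.subst₂ (λ y r → y ≤ suc (asc r))
    (≡.sym (nth-length p x [])) (≡.sym (take-length p (x ∷ []))) x≤

-- Enumeration of candidates as a tree of prefixes

count : {P : Pred (List ℕ) 0ℓ} → Decidable P → List (List ℕ) → ℤ
count P? ws = + length (filter P? ws)

count-++ : ∀ {P : Pred (List ℕ) 0ℓ} (P? : Decidable P) ws vs →
  count P? (ws ++ vs) ≡ count P? ws ℤ.+ count P? vs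
count-++ P? ws vs = ≡.trans (≡.cong (+_ ∘ length) (filter-++ P? ws vs))
  (≡.cong +_ (length-++ (filter P? ws)))

count-map : ∀ {P : Pred (List ℕ) 0ℓ} (P? : Decidable P) h ws →
  count P? (map h ws) ≡ count (P? ∘ h) ws
count-map P? h [] = ≡.refl
count-map P? h (w ∷ ws) with does (P? (h w))
... | true  = ≡.cong ℤ.suc (count-map P? h ws)
... | false = count-map P? h ws

count-none : ∀ {P : Pred (List ℕ) 0ℓ} (P? : Decidable P) ws → (∀ w → ¬ P w) → count P? ws ≡ + 0
count-none P? ws none = ≡.cong (+_ ∘ length) (filter-none P? (All.universal none ws))

open ℤTree using (∑; ∑-cong; ∑-head; ∑-++; walks)

∑-zero : ∀ n {f : ℕ → ℤ} → (∀ i → i < n → f i ≡ + 0) → ∑ n f ≡ + 0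
∑-zero n {f} e = ≡.trans (sumTo-∑ n f) (sumTo-zero n e)

count-concatMap : ∀ {P : Pred (List ℕ) 0ℓ} (P? : Decidable P) (g : ℕ → List (List ℕ)) f m →
  count P? (concatMap g (applyUpTo f m)) ≡ ∑ m (λ i → count P? (g (f i)))
count-concatMap P? g f zero    = ≡.refl
count-concatMap P? g f (suc m) = ≡.trans (count-++ P? (g (f 0)) _)
  (≡.trans (≡.cong (λ c → count P? (g (f 0)) ℤ.+ c) (count-concatMap P? g (f ∘ suc) m))
    (≡.sym (∑-head m (λ i → count P? (g (f i))))))

count-cands-suc : ∀ {P : Pred (List ℕ) 0ℓ} (P? : Decidable P) k m →
  count P? (cands (suc k) m) ≡ ∑ m (λ x → count (P? ∘ (x ∷_)) (cands k m))
count-cands-suc P? k m = ≡.trans (count-concatMap P? (λ x → map (x ∷_) (cands k m)) id m)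
  (∑-cong m λ x _ → count-map P? (x ∷_) (cands k m))

kronecker-refl : ∀ i → kronecker i i ≡ + 1
kronecker-refl zero    = ≡.refl
kronecker-refl (suc i) = kronecker-refl i

kronecker-≢ : ∀ {i j} → ¬ i ≡ j → kronecker i j ≡ + 0
kronecker-≢ {zero}  {zero}  i≢j = contradiction ≡.refl i≢j
kronecker-≢ {zero}  {suc j} _   = ≡.refl
kronecker-≢ {suc i} {zero}  _   = ≡.refl
kronecker-≢ {suc i} {suc j} i≢j = kronecker-≢ (i≢j ∘ ≡.cong suc)

module Counting (a b : ℕ) where

  Wanted : Pred (List ℕ) 0ℓ
  Wanted w = IsAscent w × asc w ≡ a × zeros w ≡ b

  wanted? : Decidable Wanted
  wanted? w = isAscent? w ×-dec (asc w ℕ.≟ a) ×-dec (zeros w ℕ.≟ b)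

  count-self : ∀ p → IsAscent p → count wanted? (p ∷ []) ≡ kronecker (asc p) a ℤ.* kronecker (zeros p) b
  count-self p ascent = cases (asc p ℕ.≟ a) (zeros p ℕ.≟ b)
    where
    reject : ¬ Wanted p → count wanted? (p ∷ []) ≡ + 0
    reject ¬w = ≡.cong (+_ ∘ length) (filter-reject wanted? {p} {[]} ¬w)
    cases : Dec (asc p ≡ a) → Dec (zeros p ≡ b) →
      count wanted? (p ∷ []) ≡ kronecker (asc p) a ℤ.* kronecker (zeros p) b
    cases (yes e) (yes e′) = ≡.trans
      (≡.cong (+_ ∘ length) (filter-accept wanted? {p} {[]} (ascent , e , e′)))
      (≡.sym (≡.cong₂ ℤ._*_ (≡.trans (≡.cong (kronecker (asc p)) (≡.sym e)) (kronecker-refl (asc p)))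
                            (≡.trans (≡.cong (kronecker (zeros p)) (≡.sym e′)) (kronecker-refl (zeros p)))))
    cases (no asc≢) _ = ≡.trans (reject λ w → asc≢ (proj₁ (proj₂ w)))
      (≡.sym (≡.trans (≡.cong (ℤ._* kronecker (zeros p) b) (kronecker-≢ asc≢)) (ℤP.*-zeroˡ (kronecker (zeros p) b))))
    cases (yes _) (no zeros≢) = ≡.trans (reject λ w → zeros≢ (proj₂ (proj₂ w)))
      (≡.sym (≡.trans (≡.cong (kronecker (asc p) a ℤ.*_) (kronecker-≢ zeros≢)) (ℤP.*-zeroʳ (kronecker (asc p) a))))

  state : List ℕ → ℕ → State
  state q l = asc (q ∷ʳ l) , l , zeros (q ∷ʳ l)

  state-∷ʳ : ∀ q l x → state (q ∷ʳ l) x ≡ next (state q l) x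
  state-∷ʳ q l x = ≡.cong₂ (λ i j → i , x , j) (asc-∷ʳ q l x) (zeros-∷ʳ (q ∷ʳ l) x)

  -- The statistics and the bound on the next letter depend on the prefix only through its state, so
  -- enumerating suffixes follows `walks`. The length condition keeps every admissible letter below
  -- m; a larger letter violates the bound whatever follows it.
  count-extensions : ∀ k m q l → IsAscent (q ∷ʳ l) → length (q ∷ʳ l) ℕ.+ k ≤ m →
    count (λ c → wanted? ((q ∷ʳ l) ++ c)) (cands k m) ≡ walks (indicator a b) k (state q l)
  count-extensions zero m q l ascent _ = ≡.trans (≡.sym (count-map wanted? ((q ∷ʳ l) ++_) ([] ∷ [])))
    (≡.trans (≡.cong (λ p → count wanted? (p ∷ [])) (++-identityʳ (q ∷ʳ l))) (count-self (q ∷ʳ l) ascent))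
  count-extensions (suc k) m q l ascent room = begin
    count (λ c → wanted? (p ++ c)) (cands (suc k) m)
      ≡⟨ count-cands-suc (λ c → wanted? (p ++ c)) k m ⟩
    ∑ m F
      ≡⟨ ≡.cong (λ n → ∑ n F) (ℕP.m+[n∸m]≡n enough) ⟨
    ∑ (2+asc ℕ.+ (m ∸ 2+asc)) F
      ≡⟨ ∑-++ 2+asc (m ∸ 2+asc) F ⟩
    ∑ 2+asc F ℤ.+ ∑ (m ∸ 2+asc) (λ i → F (2+asc ℕ.+ i))
      ≡⟨ ≡.cong₂ ℤ._+_ (∑-cong 2+asc allowed) (∑-zero (m ∸ 2+asc) λ i _ → forbidden i) ⟩
    ∑ 2+asc (λ x → walks (indicator a b) k (next (state q l) x)) ℤ.+ + 0
      ≡⟨ ℤP.+-identityʳ _ ⟩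
    walks (indicator a b) (suc k) (state q l) ∎
    where
    open ≡.≡-Reasoning
    p = q ∷ʳ l
    2+asc = 2 ℕ.+ asc p
    F : ℕ → ℤ
    F x = count (λ c → wanted? (p ++ x ∷ c)) (cands k m)
    room′ : suc (length p ℕ.+ k) ≤ m
    room′ = ≡.subst (_≤ m) (ℕP.+-suc (length p) k) room
    enough : 2+asc ≤ m
    -- A nonempty p has at most length p - 1 ascents; the letter still to be appended supplies the
    -- remaining unit.
    enough = ℕP.≤-trans (s≤s (ℕP.≤-trans
      (≡.subst (suc (asc p) ≤_) (≡.sym (length-∷ʳ q l))
        (s≤s (≡.subst (λ n → asc p ≤ n ∸ 1) (length-∷ʳ q l) (asc-bound p))))
      (ℕP.m≤m+n (length p) k))) room′
    allowed : ∀ x → x < 2+asc → F x ≡ walks (indicator a b) k (next (state q l) x)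
    allowed x (s≤s x≤) = ≡.trans
      (≡.cong (+_ ∘ length) (filter-≐ (λ c → wanted? (p ++ x ∷ c)) (λ c → wanted? ((p ∷ʳ x) ++ c))
        ( (λ {c} → ≡.subst Wanted (≡.sym (++-assoc p (x ∷ []) c)))
        , (λ {c} → ≡.subst Wanted (++-assoc p (x ∷ []) c))) (cands k m)))
      (≡.trans (count-extensions k m p x (IsAscent-∷ʳ q l x ascent x≤)
          (≡.subst (λ n → n ℕ.+ k ≤ m) (≡.sym (length-∷ʳ p x)) room′))
        (≡.cong (walks (indicator a b) k) (state-∷ʳ q l x)))
    forbidden : ∀ i → F (2+asc ℕ.+ i) ≡ + 0
    forbidden i = count-none (λ c → wanted? (p ++ (2+asc ℕ.+ i) ∷ c)) (cands k m) λ c w →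
      ℕP.<⇒≱ (s≤s (ℕP.m≤m+n (suc (asc p)) i)) (IsAscent-bound q l (2+asc ℕ.+ i) c (proj₁ w))

  -- A first letter other than 0 is excluded outright, so the tree is rooted at the state of the
  -- word 0, and the alphabet of n + 1 letters is just large enough for `count-extensions`.
  ascCount-suc : ∀ n → + ascCount a b (suc n) ≡ walks (indicator a b) n (0 , 0 , 1)
  ascCount-suc n = begin
    count wanted? (cands (suc n) (suc n))
      ≡⟨ count-cands-suc wanted? n (suc n) ⟩
    ∑ (suc n) F
      ≡⟨ ∑-head n F ⟩
    F 0 ℤ.+ ∑ n (F ∘ suc)
      ≡⟨ ≡.cong₂ ℤ._+_ (count-extensions n (suc n) [] 0 (s≤s z≤n , ≡.refl , All.[]) ℕP.≤-refl)
           (∑-zero n λ x _ → count-none (λ c → wanted? (suc x ∷ c)) (cands n (suc n)) (λ { c ((_ , () , _) , _) })) ⟩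
    walks (indicator a b) n (0 , 0 , 1) ℤ.+ + 0
      ≡⟨ ℤP.+-identityʳ _ ⟩
    walks (indicator a b) n (0 , 0 , 1) ∎
    where
    open ≡.≡-Reasoning
    F : ℕ → ℤ
    F x = count (λ c → wanted? (x ∷ c)) (cands n (suc n))

theorem6 : ((s a b n : ℕ) → a < s → summand s a b n ≡ + 0)
    × ((a b n : ℕ) → + ascCount a b n ≡ sumTo (suc a) (λ s → summand s a b n))
theorem6 = summand-low , λ
  -- The empty word is rejected and `truncated 0` is an empty sum, so both compute to 0.
  { a b zero    → partial-sum 0 a b 0 z≤n
  ; a b (suc n) → ≡.trans (Counting.ascCount-suc a b n)
      (≡.trans (≡.sym (truncated-coefficient n a b)) (partial-sum (suc n) a b (suc n) ℕP.≤-refl)) }
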